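{- Let $q\geq 2$ and let $\gamma$ be an integer. A completely regular code $C$ in $H(3,q)$ with covering radius $1$, parameter $\gamma$ and $\gamma\leq\beta$ exists if and only if one of the following holds: (1) $C$ has eigenvalue $\lambda_1(3,q)$ and $0<\gamma\leq q/2$; (2) $C$ has eigenvalue $\lambda_2(3,q)$ and one of: ($\gamma$ even and $2\leq\gamma\leq q$); ($q$ even and $\frac q2\leq\gamma\leq q$); ($q$ even, $\gamma$ odd, $\gamma<\frac q2$ and Condition 1 holds for $q$ and $\gamma$); (3) $C$ has eigenvalue $\lambda_3(3,q)$ and $\gamma$ is a nonzero integer divisible by $3$. (Each case is to be read as: for the given eigenvalue, a code with that eigenvalue and parameter $\gamma$ exists iff the stated condition on $q,\gamma$ holds.)
   Context: Let $\mathcal{A}$ be a set of size $q\geq 2$. The Hamming graph $H(3,q)$ has vertex set $\mathcal{A}^3$, two tuples being adjacent iff they differ in exactly one position; it is $3(q-1)$-regular and its eigenvalues are $\lambda_i(3,q)=3(q-1)-qi$, $i=0,\dots,3$. A set $C$ of vertices is a completely regular code with covering radius $1$ if $C$ is a nonempty proper subset and there are integers $\beta$ and $\gamma\geq 1$ such that every vertex of $C$ has exactly $\beta$ neighbours outside $C$ and every vertex outside $C$ has exactly $\gamma$ neighbours in $C$. Its eigenvalues are $3(q-1)$ and $3(q-1)-(\beta+\gamma)$; "the code has eigenvalue $\lambda_i(3,q)$" ($i\geq1$) means $\beta+\gamma=qi$. Condition 1 (for $q$ and $\gamma$): there exist integers $r,s,t$ with $0<r,s,t<q$ and integers $a,b,c$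 with $0<c\leq\min\{q-s,q-t\}$, $0<b\leq \min\{t,q-r\}$, $0<a\leq\min\{r,s\}$ such that $cr=a(q-t)$, $b(q-s)=c(q-r)$, $at=bs$, and $\gamma=a+b+c$.
   Formalization: In (3) the condition γ ≤ 3q/2, forced by γ ≤ β and β+γ = 3q, is added and γ is taken to be a positive integer; without this the equivalence fails (q = 2, γ = 6, or γ = −3). Throughout, γ ranges over the non-negative integers. -}

module Defs where

open import Data.Nat using (ℕ; zero; suc; _+_; _*_; _∸_; _≤_; _<_)
open import Data.Nat.Divisibility using (_∣_)
open import Data.Fin using (Fin)
open import Data.Fin.Properties using (_≟_)
open import Data.Bool using (Bool; true; false; _∧_; if_then_else_)
open import Data.List using (List; length; filter; cartesianProduct; allFin)
open import Data.Product using (_×_; _,_; ∃; ∃-syntax)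
open import Relation.Nullary using (¬_)
open import Relation.Nullary.Decidable using (does)
open import Relation.Binary.PropositionalEquality using (_≡_)

Vertex : ℕ → Set
Vertex q = Fin q × Fin q × Fin q

vertices : (q : ℕ) → List (Vertex q)
vertices q = cartesianProduct (allFin q) (cartesianProduct (allFin q) (allFin q))

diff : ∀ {q} → Fin q → Fin q → ℕ
diff x y = if does (x ≟ y) then 0 else 1

dist : ∀ {q} → Vertex q → Vertex q → ℕ
dist (x₁ , x₂ , x₃) (y₁ , y₂ , y₃) = diff x₁ y₁ + diff x₂ y₂ + diff x₃ y₃

adjacentB : ∀ {q} → Vertex q → Vertex q → Bool
adjacentB u v = does (Data.Nat._≟_ (dist u v) 1)

notB : Bool → Bool
notB true = false
notB false = true

Code : ℕ → Set
Code q = Vertex q → Bool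

nbrsIn : ∀ {q} → Code q → Vertex q → ℕ
nbrsIn {q} C u = length (filter (λ v → (adjacentB u v ∧ C v) ≟B true) (vertices q))
  where
  _≟B_ = Data.Bool._≟_

nbrsOut : ∀ {q} → Code q → Vertex q → ℕ
nbrsOut {q} C u = length (filter (λ v → (adjacentB u v ∧ notB (C v)) ≟B true) (vertices q))
  where
  _≟B_ = Data.Bool._≟_

IsCRC1 : (q : ℕ) → Code q → (β γ : ℕ) → Set
IsCRC1 q C β γ =
  (∃[ v ] C v ≡ true) ×
  (∃[ v ] C v ≡ false) ×
  1 ≤ γ ×
  (∀ v → C v ≡ true → nbrsOut C v ≡ β) ×
  (∀ v → C v ≡ false → nbrsIn C v ≡ γ)

-- There is a CRC with covering radius 1 in H(3,q), parameter γ, γ ≤ β,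
-- having eigenvalue λ_i(3,q) (i.e. β + γ = q i).
CodeExists : (q i γ : ℕ) → Set
CodeExists q i γ = ∃[ C ] ∃[ β ] (IsCRC1 q C β γ × γ ≤ β × β + γ ≡ q * i)

Condition1 : (q γ : ℕ) → Set
Condition1 q γ =
  ∃[ r ] ∃[ s ] ∃[ t ] ∃[ a ] ∃[ b ] ∃[ c ]
    (0 < r × r < q × 0 < s × s < q × 0 < t × t < q ×
     0 < c × c ≤ q ∸ s × c ≤ q ∸ t ×
     0 < b × b ≤ t × b ≤ q ∸ r ×
     0 < a × a ≤ r × a ≤ s ×
     c * r ≡ a * (q ∸ t) ×
     b * (q ∸ s) ≡ c * (q ∸ r) ×
     a * t ≡ b * s ×
     γ ≡ a + b + c)

-- conditions of the theorem (q/2 bounds written with 2γ to avoid division)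
Cond-λ1 : (q γ : ℕ) → Set
Cond-λ1 q γ = 0 < γ × 2 * γ ≤ q

data Cond-λ2 (q γ : ℕ) : Set where
  even-γ  : 2 ∣ γ → 2 ≤ γ → γ ≤ q → Cond-λ2 q γ
  even-q  : 2 ∣ q → q ≤ 2 * γ → γ ≤ q → Cond-λ2 q γ
  odd-γ   : 2 ∣ q → ¬ (2 ∣ γ) → 2 * γ < q → Condition1 q γ → Cond-λ2 q γ

-- nonzero, divisible by 3, and γ ≤ 3q/2 (the latter is forced by γ ≤ β,
-- β + γ = 3q)
Cond-λ3 : (q γ : ℕ) → Set
Cond-λ3 q γ = 0 < γ × 3 ∣ γ × 2 * γ ≤ 3 * q

{-# OPTIONS --safe #-}

-- Write f for the indicator of the code. A code is completely regular with covering radius 1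
-- and eigenvalue λᵢ exactly when, for every vertex v, the numbers of its points on the three lines
-- through v add up to γ + q(3 - i) f(v).
--
-- For i = 3 all these sums are γ, and averaging over planes shows that every line has γ/3 points.
-- For i = 2 every plane has qγ/2 points, so γ or q is even. If moreover 2γ < q, a line not contained
-- in the code has at most γ points, so each point of the code is on exactly one full line and the
-- code is a disjoint union of three cylinders p(x,y), r(x,z), s(y,z) in the coordinate directions.
-- Their base graphs are biregular; counting their edges gives Condition 1 as soon as γ is odd.
--
-- Conversely, the codes are assembled from boxes and cylinders over biregular bipartite graphs.
-- The edges of such a graph are read off from the jumps of ⌊s / n⌋: its row sums come from Hermite's
-- identity ∑_{j<n} ⌊(s + j) / n⌋ = s, and its column sums telescope.
module Submission where

open import Defs
import Data.Bool as Bool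
open import Data.Bool using (Bool; true; false; _∧_; _∨_; not; if_then_else_)
open import Data.Bool.Properties using (¬-not)
import Data.Fin as Fin
open import Data.Fin using (Fin; zero; suc; toℕ; fromℕ<)
open import Data.Fin.Properties using (toℕ<n; ¬∀⟶∃¬; nonZeroIndex)
open import Data.List using (List; []; _∷_; _++_; length; filter; map; tabulate; allFin; cartesianProduct)
open import Data.List.Properties using (map-++; map-∘; map-tabulate)
open import Data.Nat
  using (ℕ; zero; suc; _+_; _*_; _∸_; _≤_; _<_; z≤n; s≤s; _≟_; _≤?_; _<ᵇ_; _/_; NonZero; >-nonZero)
open import Data.Nat.Divisibility using (_∣_; divides; _∣?_; ∣-refl; ∣⇒≤; n∣m*n)
open import Data.Nat.DivMod using (m<n⇒m/n≡0; n/n≡1; m*n/n≡m; /-monoˡ-≤; +-distrib-/-∣ʳ)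
open import Data.Nat.ListAction using () renaming (sum to sumᴸ)
open import Data.Nat.ListAction.Properties using (sum-++)
open import Data.Nat.Primality using (euclidsLemma; prime[2])
open import Data.Nat.Properties hiding (_≟_; _≤?_)
open import Data.Nat.Tactic.RingSolver using (solve-∀)
open import Data.Product using (_×_; _,_; ∃-syntax; proj₁; proj₂)
open import Data.Sum using (_⊎_; inj₁; inj₂; [_,_]′)
open import Function using (_∘_; id)
open import Function.Bundles using (_⇔_; mk⇔)
open import Relation.Binary.PropositionalEquality
open import Relation.Nullary using (Dec; does; yes; no; ¬_; contradiction)
open import Relation.Nullary.Decidable using (dec-true; dec-false)
open import Relation.Unary using (Decidable)
import Algebra.Properties.Semiring.Sum +-*-semiring as Sum

-- Opaque, so that unification treats sum g ≡ sum h as an equation between g and h.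
opaque
  sum : ∀ {n} → (Fin n → ℕ) → ℕ
  sum = Sum.sum

  sum-zero : (g : Fin 0 → ℕ) → sum g ≡ 0
  sum-zero g = refl

  sum-suc : ∀ {n} (g : Fin (suc n) → ℕ) → sum g ≡ g zero + sum (g ∘ suc)
  sum-suc g = refl

  sum-cong : ∀ {n} {g h : Fin n → ℕ} → (∀ i → g i ≡ h i) → sum g ≡ sum h
  sum-cong = Sum.sum-cong-≗

  sum-+ : ∀ {n} (g h : Fin n → ℕ) → sum (λ i → g i + h i) ≡ sum g + sum h
  sum-+ = Sum.∑-distrib-+

  sum-comm : ∀ {m n} (g : Fin m → Fin n → ℕ) → sum (λ i → sum (g i)) ≡ sum (λ j → sum λ i → g i j)
  sum-comm = Sum.∑-comm

  *-sum : ∀ {n} c (g : Fin n → ℕ) → c * sum g ≡ sum (λ i → c * g i)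
  *-sum = Sum.*-distribˡ-sum

-- Indicators and finite sums

𝟙 : Bool → ℕ
𝟙 b = if b then 1 else 0

𝟙-∧ : ∀ a b → 𝟙 (a ∧ b) ≡ 𝟙 a * 𝟙 b
𝟙-∧ true  b = sym (*-identityˡ (𝟙 b))
𝟙-∧ false b = refl

𝟙-notB : ∀ b → 𝟙 b + 𝟙 (notB b) ≡ 1
𝟙-notB true  = refl
𝟙-notB false = refl

length-filter-≟true : ∀ {A : Set} (b : A → Bool) xs →
  length (filter (λ v → b v Bool.≟ true) xs) ≡ sumᴸ (map (𝟙 ∘ b) xs)
length-filter-≟true b [] = refl
length-filter-≟true b (x ∷ xs) with b x
... | true  = cong suc (length-filter-≟true b xs)
... | false = length-filter-≟true b xs

sumᴸ-allFin : ∀ n (g : Fin n → ℕ) → sumᴸ (map g (allFin n)) ≡ sum g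
sumᴸ-allFin n g = trans (cong sumᴸ (map-tabulate id g)) (go n g)
  where
  go : ∀ n (g : Fin n → ℕ) → sumᴸ (tabulate g) ≡ sum g
  go zero    g = sym (sum-zero g)
  go (suc n) g = trans (cong (g zero +_) (go n (g ∘ suc))) (sym (sum-suc g))

sumᴸ-cartesianProduct : ∀ {A B : Set} (g : A × B → ℕ) xs ys →
  sumᴸ (map g (cartesianProduct xs ys)) ≡ sumᴸ (map (λ x → sumᴸ (map (λ y → g (x , y)) ys)) xs)
sumᴸ-cartesianProduct g []       ys = refl
sumᴸ-cartesianProduct g (x ∷ xs) ys = begin
  sumᴸ (map g (map (x ,_) ys ++ cartesianProduct xs ys))
    ≡⟨ cong sumᴸ (map-++ g (map (x ,_) ys) _) ⟩
  sumᴸ (map g (map (x ,_) ys) ++ map g (cartesianProduct xs ys))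
    ≡⟨ sum-++ (map g (map (x ,_) ys)) _ ⟩
  sumᴸ (map g (map (x ,_) ys)) + sumᴸ (map g (cartesianProduct xs ys))
    ≡⟨ cong₂ _+_ (cong sumᴸ (sym (map-∘ ys))) (sumᴸ-cartesianProduct g xs ys) ⟩
  sumᴸ (map (λ y → g (x , y)) ys) + sumᴸ (map (λ x → sumᴸ (map (λ y → g (x , y)) ys)) xs) ∎
  where open ≡-Reasoning

sum³ : ∀ {q} → (Fin q → Fin q → Fin q → ℕ) → ℕ
sum³ g = sum λ x → sum λ y → sum λ z → g x y z

sum³-cong : ∀ {q} {g h : Fin q → Fin q → Fin q → ℕ} →
  (∀ x y z → g x y z ≡ h x y z) → sum³ g ≡ sum³ h
sum³-cong e = sum-cong λ x → sum-cong λ y → sum-cong (e x y)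

sum³-+ : ∀ {q} (g h : Fin q → Fin q → Fin q → ℕ) →
  sum³ (λ x y z → g x y z + h x y z) ≡ sum³ g + sum³ h
sum³-+ g h =
  trans (sum-cong λ x →
    trans (sum-cong λ y → sum-+ (g x y) (h x y)) (sum-+ _ _))
  (sum-+ (λ x → sum λ y → sum λ z → g x y z) _)

sum-vertices : ∀ q (g : Vertex q → ℕ) →
  sumᴸ (map g (vertices q)) ≡ sum³ (λ x y z → g (x , y , z))
sum-vertices q g =
  trans (sumᴸ-cartesianProduct g (allFin q) _)
  (trans (sumᴸ-allFin q _) (sum-cong λ x →
    trans (sumᴸ-cartesianProduct _ (allFin q) _)
    (trans (sumᴸ-allFin q _) (sum-cong λ y → sumᴸ-allFin q _))))

-- Neighbour counts and the line equation

δ : ∀ {n} → Fin n → Fin n → ℕ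
δ i j = 𝟙 (does (i Fin.≟ j))

sum-const : ∀ n c → sum {n} (λ _ → c) ≡ n * c
sum-const zero    c = sum-zero _
sum-const (suc n) c = trans (sum-suc _) (cong (c +_) (sum-const n c))

sum-δ : ∀ {n} (i : Fin n) (g : Fin n → ℕ) → sum (λ j → δ i j * g j) ≡ g i
sum-δ {suc n} zero g = begin
  sum (λ j → δ zero j * g j)     ≡⟨ sum-suc _ ⟩
  g zero + 0 + sum {n} (λ _ → 0) ≡⟨ cong (g zero + 0 +_) (trans (sum-const n 0) (*-zeroʳ n)) ⟩
  g zero + 0 + 0                 ≡⟨ trans (+-identityʳ _) (+-identityʳ _) ⟩
  g zero                         ∎
  where open ≡-Reasoning
sum-δ {suc n} (suc i) g = trans (sum-suc _) (sum-δ i (g ∘ suc))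

-- The right side counts pairs of agreeing coordinates. That number is 1 if exactly two coordinates
-- agree, which is adjacency, 3 if all agree, which the correction term absorbs, and 0 otherwise.
adjacency : ∀ a b c →
  𝟙 (does ((if a then 0 else 1) + (if b then 0 else 1) + (if c then 0 else 1) ≟ 1))
    + 3 * (𝟙 a * (𝟙 b * 𝟙 c))
  ≡ 𝟙 a * 𝟙 b + 𝟙 a * 𝟙 c + 𝟙 b * 𝟙 c
adjacency true  true  true  = refl
adjacency true  true  false = refl
adjacency true  false true  = refl
adjacency true  false false = refl
adjacency false true  true  = refl
adjacency false true  false = refl
adjacency false false true  = refl
adjacency false false false = refl

module LineSums {q : ℕ} (f : Fin q → Fin q → Fin q → ℕ) where
  ∣z : Fin q → Fin q → ℕ
  ∣z x y = sum λ z → f x y z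
  ∣y : Fin q → Fin q → ℕ
  ∣y x z = sum λ y → f x y z
  ∣x : Fin q → Fin q → ℕ
  ∣x y z = sum λ x → f x y z

  -- A vertex lies on all three of its lines, so its own value enters three times and that of each
  -- neighbour once.
  lines : Fin q → Fin q → Fin q → ℕ
  lines x y z = ∣z x y + ∣y x z + ∣x y z

open LineSums

indicator : ∀ {q} → Code q → Fin q → Fin q → Fin q → ℕ
indicator C x y z = 𝟙 (C (x , y , z))

-- The identity `adjacency` is multiplied by the indicator and summed over all vertices; each
-- product of two deltas then collapses the triple sum to one line sum.
nbrsIn-lines : ∀ {q} (C : Code q) x y z →
  nbrsIn C (x , y , z) + 3 * indicator C x y z ≡ lines (indicator C) x y z
nbrsIn-lines {q} C x y z = begin
  nbrsIn C (x , y , z) + 3 * f x y z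
    ≡⟨ cong₂ _+_ nbrs here ⟩
  sum³ (λ x′ y′ z′ → adj x′ y′ z′ * f x′ y′ z′) + sum³ (λ x′ y′ z′ → 3 * (δ x x′ * (δ y y′ * δ z z′)) * f x′ y′ z′)
    ≡⟨ sum³-+ (λ x′ y′ z′ → adj x′ y′ z′ * f x′ y′ z′) _ ⟨
  sum³ (λ x′ y′ z′ → adj x′ y′ z′ * f x′ y′ z′ + 3 * (δ x x′ * (δ y y′ * δ z z′)) * f x′ y′ z′)
    ≡⟨ sum³-cong (λ x′ y′ z′ → pointwise x′ y′ z′) ⟩
  sum³ (λ x′ y′ z′ → δ x x′ * (δ y y′ * f x′ y′ z′) + δ x x′ * (δ z z′ * f x′ y′ z′) + δ y y′ * (δ z z′ * f x′ y′ z′))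
    ≡⟨ sum³-+ (λ x′ y′ z′ → δ x x′ * (δ y y′ * f x′ y′ z′) + δ x x′ * (δ z z′ * f x′ y′ z′)) _ ⟩
  sum³ (λ x′ y′ z′ → δ x x′ * (δ y y′ * f x′ y′ z′) + δ x x′ * (δ z z′ * f x′ y′ z′)) + sum³ (λ x′ y′ z′ → δ y y′ * (δ z z′ * f x′ y′ z′))
    ≡⟨ cong (_+ sum³ (λ x′ y′ z′ → δ y y′ * (δ z z′ * f x′ y′ z′))) (sum³-+ (λ x′ y′ z′ → δ x x′ * (δ y y′ * f x′ y′ z′)) _) ⟩
  sum³ (λ x′ y′ z′ → δ x x′ * (δ y y′ * f x′ y′ z′)) + sum³ (λ x′ y′ z′ → δ x x′ * (δ z z′ * f x′ y′ z′)) + sum³ (λ x′ y′ z′ → δ y y′ * (δ z z′ * f x′ y′ z′))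
    ≡⟨ cong₂ _+_ (cong₂ _+_ lz ly) lx ⟩
  lines f x y z ∎
  where
  open ≡-Reasoning
  f : Fin q → Fin q → Fin q → ℕ
  f = indicator C
  adj : Fin q → Fin q → Fin q → ℕ
  adj x′ y′ z′ = 𝟙 (adjacentB (x , y , z) (x′ , y′ , z′))
  nbrs : nbrsIn C (x , y , z) ≡ sum³ (λ x′ y′ z′ → adj x′ y′ z′ * f x′ y′ z′)
  nbrs = trans (length-filter-≟true (λ v → adjacentB (x , y , z) v ∧ C v) (vertices q))
    (trans (sum-vertices q _) (sum³-cong λ x′ y′ z′ → 𝟙-∧ (adjacentB (x , y , z) (x′ , y′ , z′)) _))
  here : 3 * f x y z ≡ sum³ (λ x′ y′ z′ → 3 * (δ x x′ * (δ y y′ * δ z z′)) * f x′ y′ z′)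
  here = sym (trans
    (sum-cong λ x′ → trans
      (sum-cong λ y′ → trans
        (sum-cong λ z′ → regroup (δ x x′) (δ y y′) (δ z z′) (f x′ y′ z′))
        (sum-δ z (λ z′ → δ y y′ * (δ x x′ * (3 * f x′ y′ z′)))))
      (sum-δ y (λ y′ → δ x x′ * (3 * f x′ y′ z))))
    (sum-δ x (λ x′ → 3 * f x′ y z)))
    where
    regroup : ∀ a b c d → 3 * (a * (b * c)) * d ≡ c * (b * (a * (3 * d)))
    regroup = solve-∀
  pointwise : ∀ x′ y′ z′ →
    adj x′ y′ z′ * f x′ y′ z′ + 3 * (δ x x′ * (δ y y′ * δ z z′)) * f x′ y′ z′
    ≡ δ x x′ * (δ y y′ * f x′ y′ z′) + δ x x′ * (δ z z′ * f x′ y′ z′) + δ y y′ * (δ z z′ * f x′ y′ z′)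
  pointwise x′ y′ z′ = begin
    adj x′ y′ z′ * w + 3 * (a * (b * c)) * w   ≡⟨ *-distribʳ-+ w (adj x′ y′ z′) _ ⟨
    (adj x′ y′ z′ + 3 * (a * (b * c))) * w     ≡⟨ cong (_* w) (adjacency (does (x Fin.≟ x′)) (does (y Fin.≟ y′)) (does (z Fin.≟ z′))) ⟩
    (a * b + a * c + b * c) * w                ≡⟨ regroup a b c w ⟩
    a * (b * w) + a * (c * w) + b * (c * w)    ∎
    where
    a = δ x x′
    b = δ y y′
    c = δ z z′
    w = f x′ y′ z′
    regroup : ∀ a b c w → (a * b + a * c + b * c) * w ≡ a * (b * w) + a * (c * w) + b * (c * w)
    regroup = solve-∀
  lz : sum³ (λ x′ y′ z′ → δ x x′ * (δ y y′ * f x′ y′ z′)) ≡ ∣z f x y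
  lz = trans (sum-cong λ x′ → trans
      (sum-cong λ y′ → trans (sym (*-sum (δ x x′) (λ z′ → δ y y′ * f x′ y′ z′)))
                              (cong (δ x x′ *_) (sym (*-sum (δ y y′) (f x′ y′)))))
      (trans (sym (*-sum (δ x x′) (λ y′ → δ y y′ * ∣z f x′ y′)))
             (cong (δ x x′ *_) (sum-δ y (∣z f x′)))))
    (sum-δ x (λ x′ → ∣z f x′ y))
  ly : sum³ (λ x′ y′ z′ → δ x x′ * (δ z z′ * f x′ y′ z′)) ≡ ∣y f x z
  ly = trans (sum-cong λ x′ → trans
      (sum-cong λ y′ → trans (sym (*-sum (δ x x′) (λ z′ → δ z z′ * f x′ y′ z′)))
                              (cong (δ x x′ *_) (sum-δ z (f x′ y′))))
      (sym (*-sum (δ x x′) (λ y′ → f x′ y′ z))))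
    (sum-δ x (λ x′ → ∣y f x′ z))
  lx : sum³ (λ x′ y′ z′ → δ y y′ * (δ z z′ * f x′ y′ z′)) ≡ ∣x f y z
  lx = sum-cong λ x′ → trans
      (sum-cong λ y′ → trans (sym (*-sum (δ y y′) (λ z′ → δ z z′ * f x′ y′ z′)))
                              (cong (δ y y′ *_) (sum-δ z (f x′ y′))))
      (sum-δ y (λ y′ → f x′ y′ z))

-- This is `lines f = γ + q (3 - i) f` with the negative term moved to the left, which avoids
-- truncated subtraction. Values in `ℕ` allow sums of indicators that are only later recognised as
-- indicators.
LineEquation : ∀ {q} → (Fin q → Fin q → Fin q → ℕ) → (i γ : ℕ) → Set
LineEquation {q} f i γ = ∀ x y z → lines f x y z + q * i * f x y z ≡ γ + 3 * q * f x y z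

sum-complement : ∀ {n} {g h : Fin n → ℕ} → (∀ i → g i + h i ≡ 1) → sum g + sum h ≡ n
sum-complement {n} {g} {h} e =
  trans (sym (sum-+ g h)) (trans (sum-cong e) (trans (sum-const n 1) (*-identityʳ n)))

lines-complement : ∀ {q} (C : Code q) x y z →
  lines (indicator C) x y z + lines (indicator (notB ∘ C)) x y z ≡ 3 * q
lines-complement {q} C x y z = begin
  ∣z f x y + ∣y f x z + ∣x f y z + (∣z f′ x y + ∣y f′ x z + ∣x f′ y z)
    ≡⟨ regroup (∣z f x y) (∣y f x z) (∣x f y z) (∣z f′ x y) (∣y f′ x z) (∣x f′ y z) ⟩
  (∣z f x y + ∣z f′ x y) + ((∣y f x z + ∣y f′ x z) + (∣x f y z + ∣x f′ y z))
    ≡⟨ cong₂ _+_ (sum-complement λ z′ → 𝟙-notB (C (x , y , z′)))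
        (cong₂ _+_ (sum-complement λ y′ → 𝟙-notB (C (x , y′ , z)))
                   (sum-complement λ x′ → 𝟙-notB (C (x′ , y , z)))) ⟩
  q + (q + q)
    ≡⟨ cong (λ t → q + (q + t)) (+-identityʳ q) ⟨
  3 * q ∎
  where
  open ≡-Reasoning
  f f′ : Fin q → Fin q → Fin q → ℕ
  f  = indicator C
  f′ = indicator (notB ∘ C)
  regroup : ∀ a b c d e g → a + b + c + (d + e + g) ≡ (a + d) + ((b + e) + (c + g))
  regroup = solve-∀

lines-in : ∀ {q} (C : Code q) x y z → C (x , y , z) ≡ false →
  lines (indicator C) x y z ≡ nbrsIn C (x , y , z)
lines-in C x y z v∉C = sym (trans (sym (+-identityʳ _))
  (trans (cong (λ b → nbrsIn C (x , y , z) + 3 * 𝟙 b) (sym v∉C)) (nbrsIn-lines C x y z)))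

-- A vertex of the code lies outside the complementary code, where `lines-in` applies.
lines-out : ∀ {q} (C : Code q) x y z → C (x , y , z) ≡ true →
  lines (indicator C) x y z + nbrsOut C (x , y , z) ≡ 3 * q
lines-out {q} C x y z v∈C = trans
  (cong (lines (indicator C) x y z +_) (sym (lines-in (notB ∘ C) x y z (cong notB v∈C))))
  (lines-complement C x y z)

-- Off the code the terms in `f` vanish and the line sum is `γ`. On the code it is `3q - β`, and
-- `β + γ = q i` eliminates `β`.
crc⇒lineEquation : ∀ {q i β γ} {C : Code q} →
  IsCRC1 q C β γ → β + γ ≡ q * i → LineEquation (indicator C) i γ
crc⇒lineEquation {q} {i} {β} {γ} {C} (_ , _ , _ , out , inn) β+γ x y z with C (x , y , z) in eq
... | false = cong₂ _+_ (trans (lines-in C x y z eq) (inn _ eq))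
                        (trans (*-zeroʳ (q * i)) (sym (*-zeroʳ (3 * q))))
... | true = begin
  ℓ + q * i * 1   ≡⟨ cong (ℓ +_) (trans (*-identityʳ (q * i)) (sym β+γ)) ⟩
  ℓ + (β + γ)     ≡⟨ +-assoc ℓ β γ ⟨
  ℓ + β + γ       ≡⟨ cong (λ b → ℓ + b + γ) (out _ eq) ⟨
  ℓ + nbrsOut C (x , y , z) + γ ≡⟨ cong (_+ γ) (lines-out C x y z eq) ⟩
  3 * q + γ       ≡⟨ +-comm (3 * q) γ ⟩
  γ + 3 * q       ≡⟨ cong (γ +_) (*-identityʳ (3 * q)) ⟨
  γ + 3 * q * 1   ∎
  where
  open ≡-Reasoning
  ℓ = lines (indicator C) x y z

length-filter>0 : ∀ {A : Set} {P : A → Set} (P? : Decidable P) xs → 0 < length (filter P? xs) → ∃[ x ] P x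
length-filter>0 P? (x ∷ xs) pos with P? x
... | yes px = x , px
... | no  _  = length-filter>0 P? xs pos

nbrsIn>0 : ∀ {q} (C : Code q) u → 0 < nbrsIn C u → ∃[ v ] C v ≡ true
nbrsIn>0 {q} C u pos with length-filter>0 (λ v → (adjacentB u v ∧ C v) Bool.≟ true) (vertices q) pos
... | v , e with adjacentB u v
...   | true = v , e

notB-true : ∀ b → notB b ≡ true → b ≡ false
notB-true false _ = refl

-- The eigenvalue forces `β = q i - γ`, and this is at least `γ`. The code and its complement are
-- both nonempty because the vertex `u` lies in one of them and, as `γ` and `β` are positive, has a
-- neighbour in the other.
lineEquation⇒codeExists : ∀ {q i γ} (C : Code q) → Fin q → 0 < γ → 2 * γ ≤ q * i →
  LineEquation (indicator C) i γ → CodeExists q i γ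
lineEquation⇒codeExists {q} {i} {γ} C o 0<γ 2γ≤qi eqn =
  C , β , (member (C u) refl , nonmember (C u) refl , 0<γ , out , inn) , γ≤β , β+γ
  where
  open ≡-Reasoning
  u : Vertex q
  u = o , o , o
  β : ℕ
  β = q * i ∸ γ
  β+γ : β + γ ≡ q * i
  β+γ = m∸n+n≡m (≤-trans (m≤m+n γ (γ + 0)) 2γ≤qi)
  γ≤β : γ ≤ β
  γ≤β = m+n≤o⇒m≤o∸n γ (≤-trans (≤-reflexive (cong (γ +_) (sym (+-identityʳ γ)))) 2γ≤qi)
  inn : ∀ v → C v ≡ false → nbrsIn C v ≡ γ
  inn (x , y , z) v∉C with e ← eqn x y z rewrite v∉C | *-zeroʳ (q * i) | *-zeroʳ (3 * q) =
    trans (sym (lines-in C x y z v∉C)) (+-cancelʳ-≡ 0 _ _ e)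
  out : ∀ v → C v ≡ true → nbrsOut C v ≡ β
  out (x , y , z) v∈C with e ← eqn x y z rewrite v∈C = +-cancelˡ-≡ (ℓ + γ) _ _ (begin
    ℓ + γ + nbrsOut C (x , y , z)   ≡⟨ regroup ℓ γ _ ⟩
    ℓ + nbrsOut C (x , y , z) + γ   ≡⟨ cong (_+ γ) (lines-out C x y z v∈C) ⟩
    3 * q + γ                       ≡⟨ +-comm (3 * q) γ ⟩
    γ + 3 * q                       ≡⟨ cong (γ +_) (*-identityʳ (3 * q)) ⟨
    γ + 3 * q * 1                   ≡⟨ e ⟨
    ℓ + q * i * 1                   ≡⟨ cong (ℓ +_) (trans (*-identityʳ (q * i)) (sym β+γ)) ⟩
    ℓ + (β + γ)                     ≡⟨ cong (ℓ +_) (+-comm β γ) ⟩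
    ℓ + (γ + β)                     ≡⟨ +-assoc ℓ γ β ⟨
    ℓ + γ + β                       ∎)
    where
    ℓ = lines (indicator C) x y z
    regroup : ∀ a b c → a + b + c ≡ a + c + b
    regroup = solve-∀
  member : ∀ b → C u ≡ b → ∃[ v ] C v ≡ true
  member true  e = u , e
  member false e = nbrsIn>0 C u (subst (0 <_) (sym (inn u e)) 0<γ)
  nonmember : ∀ b → C u ≡ b → ∃[ v ] C v ≡ false
  nonmember false e = u , e
  nonmember true  e with nbrsIn>0 (notB ∘ C) u (subst (0 <_) (sym (out u e)) (<-≤-trans 0<γ γ≤β))
  ... | v , e′ = v , notB-true (C v) e′

-- Windows modulo n and biregular bipartite graphs

-- Both sides are the sum of `h` over `0, …, n`.
sum-shift : ∀ n (h : ℕ → ℕ) →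
  h 0 + sum {n} (λ j → h (suc (toℕ j))) ≡ sum {n} (λ j → h (toℕ j)) + h n
sum-shift zero    h = trans (cong (h 0 +_) (sum-zero _))
  (trans (+-identityʳ (h 0)) (cong (_+ h 0) (sym (sum-zero _))))
sum-shift (suc n) h = begin
  h 0 + sum (λ j → h (suc (toℕ j)))                          ≡⟨ cong (h 0 +_) (sum-suc _) ⟩
  h 0 + (h 1 + sum {n} (λ j → h (suc (suc (toℕ j)))))        ≡⟨ cong (h 0 +_) (sum-shift n (h ∘ suc)) ⟩
  h 0 + (sum {n} (λ j → h (suc (toℕ j))) + h (suc n))        ≡⟨ +-assoc (h 0) _ _ ⟨
  h 0 + sum {n} (λ j → h (suc (toℕ j))) + h (suc n)          ≡⟨ cong (_+ h (suc n)) (sum-suc {n} (λ j → h (toℕ j))) ⟨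
  sum {suc n} (λ j → h (toℕ j)) + h (suc n)                  ∎
  where open ≡-Reasoning

sum-telescope : ∀ n (h g : ℕ → ℕ) → (∀ i → h i + g i ≡ h (suc i)) →
  h 0 + sum {n} (λ i → g (toℕ i)) ≡ h n
sum-telescope zero    h g e = trans (cong (h 0 +_) (sum-zero _)) (+-identityʳ (h 0))
sum-telescope (suc n) h g e = begin
  h 0 + sum {suc n} (λ i → g (toℕ i))          ≡⟨ cong (h 0 +_) (sum-suc _) ⟩
  h 0 + (g 0 + sum {n} (λ i → g (suc (toℕ i)))) ≡⟨ +-assoc (h 0) (g 0) _ ⟨
  h 0 + g 0 + sum {n} (λ i → g (suc (toℕ i)))  ≡⟨ cong (_+ sum {n} (λ i → g (suc (toℕ i)))) (e 0) ⟩
  h 1 + sum {n} (λ i → g (suc (toℕ i)))        ≡⟨ sum-telescope n (h ∘ suc) (g ∘ suc) (e ∘ suc) ⟩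
  h (suc n)                                    ∎
  where open ≡-Reasoning

[m+kn]/n : ∀ m k n .{{_ : NonZero n}} → (m + k * n) / n ≡ m / n + k
[m+kn]/n m k n = trans (+-distrib-/-∣ʳ m (n∣m*n k)) (cong (m / n +_) (m*n/n≡m k n))

[m+n]/n : ∀ m n .{{_ : NonZero n}} → (m + n) / n ≡ suc (m / n)
[m+n]/n m n = trans (+-distrib-/-∣ʳ m ∣-refl) (trans (cong (m / n +_) (n/n≡1 n)) (+-comm (m / n) 1))

-- Raising `s` by one drops the term `s / n` and adds `(s + n) / n`, which is larger by one.
hermite : ∀ n .{{_ : NonZero n}} s → sum {n} (λ j → (s + toℕ j) / n) ≡ s
hermite n zero    = trans (sum-cong λ j → m<n⇒m/n≡0 (toℕ<n j)) (trans (sum-const n 0) (*-zeroʳ n))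
hermite n (suc s) = +-cancelˡ-≡ (s / n) _ _ (begin
  s / n + sum {n} (λ j → (suc s + toℕ j) / n)
    ≡⟨ cong₂ _+_ (cong (_/ n) (sym (+-identityʳ s)))
                 (sum-cong λ j → cong (_/ n) (sym (+-suc s (toℕ j)))) ⟩
  (s + 0) / n + sum {n} (λ j → (s + suc (toℕ j)) / n)  ≡⟨ sum-shift n (λ j → (s + j) / n) ⟩
  sum {n} (λ j → (s + toℕ j) / n) + (s + n) / n        ≡⟨ cong₂ _+_ (hermite n s) ([m+n]/n s n) ⟩
  s + suc (s / n)                                      ≡⟨ +-comm s (suc (s / n)) ⟩
  suc (s / n + s)                                      ≡⟨ +-suc (s / n) s ⟨
  s / n + suc s                                        ∎)
  where open ≡-Reasoning

-- The indicator of { s ∣ ⌊(s + d) / n⌋ ≠ ⌊s / n⌋ }, that is, of a window of length d modulo n.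
window : ∀ n .{{_ : NonZero n}} → ℕ → ℕ → Bool
window n d s = does (suc (s / n) ≟ (s + d) / n)

-- As `d ≤ n`, the quotient rises by at most one between `s` and `s + d`, so a Boolean records the
-- whole jump.
window-/ : ∀ n .{{_ : NonZero n}} d s → d ≤ n → s / n + 𝟙 (window n d s) ≡ (s + d) / n
window-/ n d s d≤n = go (suc (s / n) ≟ (s + d) / n)
  where
  go : (eq? : Dec (suc (s / n) ≡ (s + d) / n)) → s / n + 𝟙 (does eq?) ≡ (s + d) / n
  go (yes e) = trans (+-comm (s / n) 1) e
  go (no ne) = trans (+-identityʳ (s / n)) (≤-antisym (/-monoˡ-≤ n (m≤m+n s d))
    (≤-pred (≤∧≢⇒< (≤-trans (/-monoˡ-≤ n (+-monoʳ-≤ s d≤n)) (≤-reflexive ([m+n]/n s n))) (ne ∘ sym))))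

-- The jumps add up to the difference of the Hermite sums at `s + d` and at `s`.
window-row : ∀ n .{{_ : NonZero n}} d s → d ≤ n → sum {n} (λ j → 𝟙 (window n d (s + toℕ j))) ≡ d
window-row n d s d≤n = +-cancelˡ-≡ s _ _ (begin
  s + sum {n} (λ j → 𝟙 (window n d (s + toℕ j)))
    ≡⟨ cong (_+ sum {n} (λ j → 𝟙 (window n d (s + toℕ j)))) (hermite n s) ⟨
  sum {n} (λ j → (s + toℕ j) / n) + sum {n} (λ j → 𝟙 (window n d (s + toℕ j)))
    ≡⟨ sum-+ (λ j → (s + toℕ j) / n) _ ⟨
  sum {n} (λ j → (s + toℕ j) / n + 𝟙 (window n d (s + toℕ j)))
    ≡⟨ sum-cong (λ j → trans (window-/ n d (s + toℕ j) d≤n) (cong (_/ n) (regroup s (toℕ j) d))) ⟩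
  sum {n} (λ j → (s + d + toℕ j) / n)
    ≡⟨ hermite n (s + d) ⟩
  s + d ∎)
  where
  open ≡-Reasoning
  regroup : ∀ a b c → a + b + c ≡ a + c + b
  regroup = solve-∀

-- The argument advances by `d` at each step, so the jumps telescope; in total it advances by
-- `d′ * n`, which raises the quotient by `d′`.
window-column : ∀ n .{{_ : NonZero n}} m d d′ s → d ≤ n → d * m ≡ d′ * n →
  sum {m} (λ i → 𝟙 (window n d (s + toℕ i * d))) ≡ d′
window-column n m d d′ s d≤n dm≡d′n = +-cancelˡ-≡ (s / n) _ _ (begin
  s / n + Σ                 ≡⟨ cong (λ t → t / n + Σ) (+-identityʳ s) ⟨
  (s + 0) / n + Σ           ≡⟨ sum-telescope m (λ i → (s + i * d) / n) (λ i → 𝟙 (window n d (s + i * d)))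
                                (λ i → trans (window-/ n d (s + i * d) d≤n) (cong (_/ n) (regroup s i d))) ⟩
  (s + m * d) / n           ≡⟨ cong (λ t → (s + t) / n) (trans (*-comm m d) dm≡d′n) ⟩
  (s + d′ * n) / n          ≡⟨ [m+kn]/n s d′ n ⟩
  s / n + d′                ∎)
  where
  open ≡-Reasoning
  Σ : ℕ
  Σ = sum {m} (λ i → 𝟙 (window n d (s + toℕ i * d)))
  regroup : ∀ s i d → s + i * d + d ≡ s + (d + i * d)
  regroup = solve-∀

-- A subset of Fin q together with an enumeration of it by 0, …, n - 1.
record Chart (q n : ℕ) : Set where
  field
    mem       : Fin q → Bool
    index     : Fin q → ℕ
    sum-chart : ∀ (h : ℕ → ℕ) → sum (λ x → 𝟙 (mem x) * h (index x)) ≡ sum {n} (λ i → h (toℕ i))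

  size : sum (λ x → 𝟙 (mem x)) ≡ n
  size = trans (sum-cong λ x → sym (*-identityʳ (𝟙 (mem x))))
    (trans (sum-chart λ _ → 1) (trans (sum-const n 1) (*-identityʳ n)))

open Chart

full : ∀ q → Chart q q
full q .mem _       = true
full q .index       = toℕ
full q .sum-chart h = sum-cong λ x → +-identityʳ (h (toℕ x))

initial : ∀ m n → Chart (m + n) m
initial m n .mem x       = toℕ x <ᵇ m
initial m n .index       = toℕ
initial m n .sum-chart h = go m h
  where
  go : ∀ m (h : ℕ → ℕ) → sum {m + n} (λ x → 𝟙 (toℕ x <ᵇ m) * h (toℕ x)) ≡ sum {m} (λ i → h (toℕ i))
  go zero    h = trans (sum-const n 0) (trans (*-zeroʳ n) (sym (sum-zero _)))
  go (suc m) h = trans (sum-suc _)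
    (trans (cong₂ _+_ (+-identityʳ (h 0)) (go m (h ∘ suc))) (sym (sum-suc _)))

final : ∀ m n → Chart (m + n) n
final m n .mem x       = not (toℕ x <ᵇ m)
-- Below `m` the truncated difference is the default 0, masked by `mem` in `sum-chart`.
final m n .index x     = toℕ x ∸ m
final m n .sum-chart h = go m
  where
  go : ∀ m → sum {m + n} (λ x → 𝟙 (not (toℕ x <ᵇ m)) * h (toℕ x ∸ m)) ≡ sum {n} (λ i → h (toℕ i))
  go zero    = sum-cong λ x → +-identityʳ (h (toℕ x))
  go (suc m) = trans (sum-suc _) (go m)

-- Membership in `I` and `J` is kept as explicit conjuncts of `edge`, so that disjointness of codes
-- built from several graphs becomes a Boolean case check in which `inner` is arbitrary.
record Biregular {q} (I J : Fin q → Bool) (d d′ : ℕ) : Set where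
  field
    inner : Fin q → Fin q → Bool

  edge : Fin q → Fin q → Bool
  edge x y = I x ∧ (J y ∧ inner x y)

  field
    row    : ∀ x → sum (λ y → 𝟙 (edge x y)) ≡ d * 𝟙 (I x)
    column : ∀ y → sum (λ x → 𝟙 (edge x y)) ≡ d′ * 𝟙 (J y)

-- The neighbours of a vertex of `I` form a cyclic interval of length `d` in `J`, and the intervals
-- of successive vertices abut. By `d * m ≡ d′ * n` they wind around `J` exactly `d′` times.
biregular : ∀ {q m n d d′} (I : Chart q m) (J : Chart q n) → 0 < n → d ≤ n → d * m ≡ d′ * n →
  Biregular (mem I) (mem J) d d′
biregular {q} {m} {n} {d} {d′} I J 0<n d≤n dm≡d′n = record
  { inner  = inner
  ; row    = row
  ; column = column
  }
  where
  instance
    n≢0 : NonZero n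
    n≢0 = >-nonZero 0<n
  inner : Fin q → Fin q → Bool
  inner x y = window n d (index J y + index I x * d)
  row : ∀ x → sum (λ y → 𝟙 (mem I x ∧ (mem J y ∧ inner x y))) ≡ d * 𝟙 (mem I x)
  row x with mem I x
  ... | false = trans (sum-const q 0) (trans (*-zeroʳ q) (sym (*-zeroʳ d)))
  ... | true  = begin
    sum (λ y → 𝟙 (mem J y ∧ inner x y))       ≡⟨ sum-cong (λ y → 𝟙-∧ (mem J y) (inner x y)) ⟩
    sum (λ y → 𝟙 (mem J y) * 𝟙 (inner x y))   ≡⟨ sum-chart J (λ j → 𝟙 (window n d (j + index I x * d))) ⟩
    sum {n} (λ j → 𝟙 (window n d (toℕ j + index I x * d)))
      ≡⟨ sum-cong (λ j → cong (𝟙 ∘ window n d) (+-comm (toℕ j) _)) ⟩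
    sum {n} (λ j → 𝟙 (window n d (index I x * d + toℕ j))) ≡⟨ window-row n d (index I x * d) d≤n ⟩
    d                                         ≡⟨ *-identityʳ d ⟨
    d * 1                                     ∎
    where open ≡-Reasoning
  column : ∀ y → sum (λ x → 𝟙 (mem I x ∧ (mem J y ∧ inner x y))) ≡ d′ * 𝟙 (mem J y)
  column y = trans (sum-cong λ x → 𝟙-∧ (mem I x) _) (go (mem J y))
    where
    go : ∀ b → sum (λ x → 𝟙 (mem I x) * 𝟙 (b ∧ inner x y)) ≡ d′ * 𝟙 b
    go false = trans (sum-cong λ x → *-zeroʳ (𝟙 (mem I x)))
      (trans (sum-const q 0) (trans (*-zeroʳ q) (sym (*-zeroʳ d′))))
    go true = trans (sum-chart I (λ i → 𝟙 (window n d (index J y + i * d))))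
      (trans (window-column n m d d′ (index J y) d≤n dm≡d′n) (sym (*-identityʳ d′)))

-- Sums of cylinders in the three coordinate directions

module Cylinders {n} (p r s : Fin n → Fin n → ℕ) where
  cylinders : Fin n → Fin n → Fin n → ℕ
  cylinders x y z = p x y + r x z + s y z

  degˣ degʸ degᶻ : Fin n → ℕ
  degˣ x = sum (λ y → p x y) + sum (λ z → r x z)
  degʸ y = sum (λ x → p x y) + sum (λ z → s y z)
  degᶻ z = sum (λ x → r x z) + sum (λ y → s y z)

  private
    sum-constˡ : ∀ c (g h : Fin n → ℕ) → sum (λ i → c + g i + h i) ≡ n * c + sum g + sum h
    sum-constˡ c g h = trans (sum-+ (λ i → c + g i) h)
      (cong (_+ sum h) (trans (sum-+ (λ _ → c) g) (cong (_+ sum g) (sum-const n c))))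

  cylinders-∣z : ∀ x y → ∣z cylinders x y ≡ n * p x y + sum (λ z → r x z) + sum (λ z → s y z)
  cylinders-∣z x y = sum-constˡ (p x y) (r x) (s y)

  cylinders-∣y : ∀ x z → ∣y cylinders x z ≡ n * r x z + sum (λ y → p x y) + sum (λ y → s y z)
  cylinders-∣y x z = trans (sum-cong λ y → cong (_+ s y z) (+-comm (p x y) (r x z)))
    (sum-constˡ (r x z) (p x) (λ y → s y z))

  cylinders-∣x : ∀ y z → ∣x cylinders y z ≡ n * s y z + sum (λ x → p x y) + sum (λ x → r x z)
  cylinders-∣x y z = trans (sum-cong λ x → rotate (p x y) (r x z) (s y z))
    (sum-constˡ (s y z) (λ x → p x y) (λ x → r x z))
    where
    rotate : ∀ a b c → a + b + c ≡ c + a + b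
    rotate = solve-∀

  -- Along its own direction a cylinder is constant and contributes `n` times its value; along each
  -- of the other two it contributes a degree of its base graph. The six degrees are then grouped by
  -- coordinate.
  cylinders-lines : ∀ x y z →
    lines cylinders x y z ≡ n * cylinders x y z + (degˣ x + degʸ y + degᶻ z)
  cylinders-lines x y z = trans
    (cong₂ _+_ (cong₂ _+_ (cylinders-∣z x y) (cylinders-∣y x z)) (cylinders-∣x y z))
    (regroup n (p x y) (r x z) (s y z) _ _ _ _ _ _)
    where
    regroup : ∀ n p r s a b c d e g →
      n * p + a + b + (n * r + c + d) + (n * s + e + g) ≡ n * (p + r + s) + ((c + a) + (e + b) + (g + d))
    regroup = solve-∀

  -- The coefficient `n` in `cylinders-lines` is `n (3 - i)` for `i = 2`, so only the degrees remain
  -- to be controlled.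
  cylinders-lineEquation : ∀ {γ} → (∀ x y z → degˣ x + degʸ y + degᶻ z ≡ γ) → LineEquation cylinders 2 γ
  cylinders-lineEquation {γ} e x y z = begin
    lines cylinders x y z + n * 2 * f         ≡⟨ cong (_+ n * 2 * f) (cylinders-lines x y z) ⟩
    n * f + (degˣ x + degʸ y + degᶻ z) + n * 2 * f ≡⟨ cong (λ t → n * f + t + n * 2 * f) (e x y z) ⟩
    n * f + γ + n * 2 * f                     ≡⟨ regroup n f γ ⟩
    γ + 3 * n * f                             ∎
    where
    open ≡-Reasoning
    f = cylinders x y z
    regroup : ∀ n f γ → n * f + γ + n * 2 * f ≡ γ + 3 * n * f
    regroup = solve-∀

lines-cong : ∀ {q} {f g : Fin q → Fin q → Fin q → ℕ} → (∀ x y z → f x y z ≡ g x y z) →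
  ∀ x y z → lines f x y z ≡ lines g x y z
lines-cong e x y z = cong₂ _+_
  (cong₂ _+_ (sum-cong (e x y)) (sum-cong λ y → e x y z)) (sum-cong λ x → e x y z)

lineEquation-cong : ∀ {q i γ} {f g : Fin q → Fin q → Fin q → ℕ} → (∀ x y z → f x y z ≡ g x y z) →
  LineEquation f i γ → LineEquation g i γ
lineEquation-cong {q} {i} {γ} e eqn x y z = subst₂ _≡_
  (cong₂ _+_ (lines-cong e x y z) (cong (q * i *_) (e x y z)))
  (cong (λ t → γ + 3 * q * t) (e x y z)) (eqn x y z)

-- Constructions

split : ∀ {q m} → m ≤ q → ∃[ n ] q ≡ m + n
split {q} {m} m≤q = q ∸ m , sym (m+[n∸m]≡n m≤q)

-- Two of the lines through a vertex lie in a plane of constant first coordinate, where the code is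
-- constant; the third line has `m` points.
half-space : ∀ m n → 0 < m + n → 0 < m → 2 * m ≤ m + n → CodeExists (m + n) 1 m
half-space m n 0<q 0<m 2m≤q = lineEquation⇒codeExists C (fromℕ< 0<q) 0<m
  (≤-trans 2m≤q (≤-reflexive (sym (*-identityʳ (m + n))))) eqn
  where
  q = m + n
  C : Code q
  C (x , _ , _) = mem (initial m n) x
  eqn : LineEquation (indicator C) 1 m
  eqn x y z = begin
    lines (indicator C) x y z + q * 1 * f
      ≡⟨ cong (_+ q * 1 * f) (cong₂ _+_ (cong₂ _+_ (sum-const q f) (sum-const q f)) (size (initial m n))) ⟩
    q * f + q * f + m + q * 1 * f   ≡⟨ regroup q f m ⟩
    m + 3 * q * f                   ∎
    where
    open ≡-Reasoning
    f = indicator C x y z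
    regroup : ∀ q f m → q * f + q * f + m + q * 1 * f ≡ m + 3 * q * f
    regroup = solve-∀

sufficiency₁ : ∀ {q γ} → 2 ≤ q → Cond-λ1 q γ → CodeExists q 1 γ
sufficiency₁ {q} {γ} 2≤q (0<γ , 2γ≤q) with split (≤-trans (m≤m+n γ (γ + 0)) 2γ≤q)
... | n , refl = half-space γ n (≤-trans (s≤s z≤n) 2≤q) 0<γ 2γ≤q

-- Along any line the coordinate sum runs through `q` consecutive integers, so a window of length
-- `k = γ / 3` in that sum meets every line in `k` points.
sufficiency₃ : ∀ {q γ} → 2 ≤ q → Cond-λ3 q γ → CodeExists q 3 γ
sufficiency₃ {q} {γ} 2≤q (0<γ , divides k refl , 2γ≤3q) =
  lineEquation⇒codeExists C (fromℕ< 0<q) 0<γ (≤-trans 2γ≤3q (≤-reflexive (*-comm 3 q))) eqn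
  where
  0<q : 0 < q
  0<q = ≤-trans (s≤s z≤n) 2≤q
  instance
    q≢0 : NonZero q
    q≢0 = >-nonZero 0<q
  k≤q : k ≤ q
  k≤q = *-cancelʳ-≤ k q 3 (≤-trans (m≤m+n (k * 3) (k * 3 + 0)) (≤-trans 2γ≤3q (≤-reflexive (*-comm 3 q))))
  C : Code q
  C (x , y , z) = window q k (toℕ x + toℕ y + toℕ z)
  row : ∀ s (g : Fin q → ℕ) → (∀ i → g i ≡ s + toℕ i) → sum (λ i → 𝟙 (window q k (g i))) ≡ k
  row s g e = trans (sum-cong λ i → cong (𝟙 ∘ window q k) (e i)) (window-row q k s k≤q)
  eqn : LineEquation (indicator C) 3 γ
  eqn x y z = cong₂ _+_
    (trans (cong₂ _+_ (cong₂ _+_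
      (row (toℕ x + toℕ y) _ (λ _ → refl))
      (row (toℕ x + toℕ z) _ (λ i → regroup (toℕ x) (toℕ i) (toℕ z))))
      (row (toℕ y + toℕ z) _ (λ i → rotate (toℕ i) (toℕ y) (toℕ z))))
      (triple k))
    (cong (_* indicator C x y z) (*-comm q 3))
    where
    regroup : ∀ a b c → a + b + c ≡ a + c + b
    regroup = solve-∀
    rotate : ∀ a b c → a + b + c ≡ b + c + a
    rotate = solve-∀
    triple : ∀ k → k + k + k ≡ k * 3
    triple = solve-∀

-- Cylinders in one direction over a `k`-regular bipartite graph suffice: the degrees at `x`, `y`,
-- `z` are `k`, `k`, 0.
square-cylinder : ∀ {q k} → 0 < q → 0 < k * 2 → k * 2 ≤ q → CodeExists q 2 (k * 2)
square-cylinder {q} {k} 0<q 0<γ γ≤q =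
  lineEquation⇒codeExists C (fromℕ< 0<q) 0<γ
    (≤-trans (*-monoʳ-≤ 2 γ≤q) (≤-reflexive (*-comm 2 q)))
    (lineEquation-cong (λ x y z → trans (+-identityʳ _) (+-identityʳ _))
      (cylinders-lineEquation degrees))
  where
  open Biregular (biregular {d = k} {d′ = k} (full q) (full q) 0<q (≤-trans (m≤m*n k 2) γ≤q) refl)
  open Cylinders {q} (λ x y → 𝟙 (edge x y)) (λ _ _ → 0) (λ _ _ → 0)
  C : Code q
  C (x , y , z) = edge x y
  sum-0 : sum {q} (λ _ → 0) ≡ 0
  sum-0 = trans (sum-const q 0) (*-zeroʳ q)
  degrees : ∀ x y z → degˣ x + degʸ y + degᶻ z ≡ k * 2
  degrees x y z = trans
    (cong₂ _+_ (cong₂ _+_ (cong₂ _+_ (row x) sum-0) (cong₂ _+_ (column y) sum-0)) (cong₂ _+_ sum-0 sum-0))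
    (regroup k)
    where
    regroup : ∀ k → k * 1 + 0 + (k * 1 + 0) + (0 + 0) ≡ k * 2
    regroup = solve-∀

𝟙-not : ∀ b → 𝟙 b + 𝟙 (not b) ≡ 1
𝟙-not true  = refl
𝟙-not false = refl

*-𝟙-not : ∀ c b → c * 𝟙 (not b) + c * 𝟙 b ≡ c
*-𝟙-not c b = trans (sym (*-distribˡ-+ c (𝟙 (not b)) (𝟙 b)))
  (trans (cong (c *_) (trans (+-comm (𝟙 (not b)) (𝟙 b)) (𝟙-not b))) (*-identityʳ c))

-- With `q` only propositionally equal to `m + n`, this still provides charts of literally `I` and
-- `not ∘ I`, the form that the disjointness checks need.
complementary : ∀ {q} m n → q ≡ m + n →
  ∃[ I ] ((∃[ A ] mem {q} {m} A ≡ I) × (∃[ B ] mem {q} {n} B ≡ not ∘ I))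
complementary m n refl = mem (initial m n) , (initial m n , refl) , (final m n , refl)

biregular′ : ∀ {q m n d d′} {I J : Fin q → Bool} → (∃[ A ] mem {q} {m} A ≡ I) → (∃[ B ] mem {q} {n} B ≡ J) →
  0 < n → d ≤ n → d * m ≡ d′ * n → Biregular I J d d′
biregular′ (A , refl) (B , refl) = biregular A B

-- Parameters: q = r + r′ = s + s′ = t + t′, so the primed sizes replace the subtractions.
three-cylinders : ∀ {q r r′ s s′ t t′ a b c} → q ≡ r + r′ → q ≡ s + s′ → q ≡ t + t′ → 0 < q →
  0 < s′ → 0 < t → 0 < t′ → 0 < c → c ≤ s′ → c ≤ t′ → b ≤ t →
  c * r ≡ a * t′ → b * s′ ≡ c * r′ → a * t ≡ b * s → 2 * (a + b + c) ≤ q * 2 →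
  CodeExists q 2 (a + b + c)
three-cylinders {q} {r} {r′} {s} {s′} {t} {t′} {a} {b} {c} eʳ eˢ eᵗ 0<q 0<s′ 0<t 0<t′ 0<c c≤s′ c≤t′ b≤t cr bs at bound =
  lineEquation⇒codeExists C (fromℕ< 0<q) (≤-trans 0<c (m≤n+m c (a + b))) bound
    (lineEquation-cong disjoint (cylinders-lineEquation degrees))
  where
  R S T : Fin q → Bool
  R = proj₁ (complementary r r′ eʳ)
  S = proj₁ (complementary s s′ eˢ)
  T = proj₁ (complementary t t′ eᵗ)
  -- The graphs `P`, `Q`, `U` live on `R′ × S′`, `R × T′`, `S × T`. Hence `R` separates the
  -- cylinders over `P` and `Q`, `S` those over `P` and `U`, and `T` those over `Q` and `U`; the
  -- degrees at `x`, `y`, `z` are constantly `c`, `b`, `a`.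
  module P = Biregular (biregular′ {d = c} {b} (proj₂ (proj₂ (complementary r r′ eʳ))) (proj₂ (proj₂ (complementary s s′ eˢ))) 0<s′ c≤s′ (sym bs))
  module Q = Biregular (biregular′ {d = c} {a} (proj₁ (proj₂ (complementary r r′ eʳ))) (proj₂ (proj₂ (complementary t t′ eᵗ))) 0<t′ c≤t′ cr)
  module U = Biregular (biregular′ {d = b} {a} (proj₁ (proj₂ (complementary s s′ eˢ))) (proj₁ (proj₂ (complementary t t′ eᵗ))) 0<t b≤t (sym at))
  open Cylinders {q} (λ x y → 𝟙 (P.edge x y)) (λ x z → 𝟙 (Q.edge x z)) (λ y z → 𝟙 (U.edge y z))
  C : Code q
  C (x , y , z) = P.edge x y ∨ (Q.edge x z ∨ U.edge y z)
  disjoint : ∀ x y z → cylinders x y z ≡ indicator C x y z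
  disjoint x y z = go (R x) (S y) (T z) (P.inner x y) (Q.inner x z) (U.inner y z)
    where
    go : ∀ i j k p r s →
      𝟙 (not i ∧ (not j ∧ p)) + 𝟙 (i ∧ (not k ∧ r)) + 𝟙 (j ∧ (k ∧ s))
      ≡ 𝟙 ((not i ∧ (not j ∧ p)) ∨ ((i ∧ (not k ∧ r)) ∨ (j ∧ (k ∧ s))))
    go true  true  true  p r s = refl
    go true  true  false p true  s = refl
    go true  true  false p false s = refl
    go true  false true  p r s = refl
    go true  false false p true  s = refl
    go true  false false p false s = refl
    go false true  true  p r s = refl
    go false true  false p r s = refl
    go false false k true  r s = refl
    go false false k false r s = refl
  degrees : ∀ x y z → degˣ x + degʸ y + degᶻ z ≡ a + b + c
  degrees x y z = begin
    degˣ x + degʸ y + degᶻ z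
      ≡⟨ cong₂ _+_ (cong₂ _+_ (cong₂ _+_ (P.row x) (Q.row x)) (cong₂ _+_ (P.column y) (U.row y)))
                   (cong₂ _+_ (Q.column z) (U.column z)) ⟩
    c * 𝟙 (not (R x)) + c * 𝟙 (R x) + (b * 𝟙 (not (S y)) + b * 𝟙 (S y)) + (a * 𝟙 (not (T z)) + a * 𝟙 (T z))
      ≡⟨ cong₂ _+_ (cong₂ _+_ (*-𝟙-not c (R x)) (*-𝟙-not b (S y))) (*-𝟙-not a (T z)) ⟩
    c + b + a ≡⟨ regroup a b c ⟩
    a + b + c ∎
    where
    open ≡-Reasoning
    regroup : ∀ a b c → c + b + a ≡ a + b + c
    regroup = solve-∀

condition1⇒codeExists : ∀ {q γ} → 2 * γ < q → Condition1 q γ → CodeExists q 2 γ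
condition1⇒codeExists {q} 2γ<q (r , s , t , a , b , c , 0<r , r<q , 0<s , s<q , 0<t , t<q ,
    0<c , c≤s′ , c≤t′ , 0<b , b≤t , b≤r′ , 0<a , a≤r , a≤s , cr , bs , at , refl) =
  three-cylinders (part r<q) (part s<q) (part t<q) (≤-<-trans z≤n 2γ<q)
    (m<n⇒0<n∸m s<q) 0<t (m<n⇒0<n∸m t<q) 0<c c≤s′ c≤t′ b≤t cr bs at
    (≤-trans (<⇒≤ 2γ<q) (m≤m*n q 2))
  where
  part : ∀ {m} → m < q → q ≡ m + (q ∸ m)
  part m<q = sym (m+[n∸m]≡n (<⇒≤ m<q))

-- This is the line equation of the code in `interpolation`: the groups on the left are its line
-- sums in directions `z`, `y`, `x`. Once the memberships are fixed, a polynomial identity remains;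
-- `u` or `v` is split only where its graph can have an edge.
interpolation-identity : ∀ X Y Z u v n d k →
  𝟙 X * 𝟙 Y * (n + d) + 𝟙 (not X) * 𝟙 (not Y) * (n + d)
    + ((n + d) + (n + d)) * (𝟙 (X ∧ (not Y ∧ u)) + 𝟙 (not X ∧ (Y ∧ v)))
  + (𝟙 X * 𝟙 Z * n + 𝟙 (not X) * 𝟙 (not Z) * (n + (d + d)) + ((k + d) * 𝟙 X + k * 𝟙 (not X)))
  + (𝟙 Y * 𝟙 Z * (n + (d + d)) + 𝟙 (not Y) * 𝟙 (not Z) * n + ((k + d) * 𝟙 (not Y) + k * 𝟙 Y))
  ≡ n + (d + d) + (k + k)
    + ((n + d) + (n + d)) * (𝟙 X * 𝟙 Y * 𝟙 Z + 𝟙 (not X) * 𝟙 (not Y) * 𝟙 (not Z)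
        + (𝟙 (X ∧ (not Y ∧ u)) + 𝟙 (not X ∧ (Y ∧ v))))
interpolation-identity true  true  true  u v = solve-∀
interpolation-identity true  true  false u v = solve-∀
interpolation-identity true  false true  true v = solve-∀
interpolation-identity true  false true  false v = solve-∀
interpolation-identity true  false false true v = solve-∀
interpolation-identity true  false false false v = solve-∀
interpolation-identity false true  true  u true = solve-∀
interpolation-identity false true  true  u false = solve-∀
interpolation-identity false true  false u true = solve-∀
interpolation-identity false true  false u false = solve-∀
interpolation-identity false false true  u v = solve-∀
interpolation-identity false false false u v = solve-∀

*-sum-const : ∀ {q} (g : Fin q → ℕ) c m → sum g ≡ m → sum (λ i → c * g i) ≡ c * m
*-sum-const g c m e = trans (sym (*-sum c g)) (cong (c *_) e)

sum-linear : ∀ {q} (g h w : Fin q → ℕ) a b {m n s} → sum g ≡ m → sum h ≡ n → sum w ≡ s →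
  sum (λ i → a * g i + b * h i + w i) ≡ a * m + b * n + s
sum-linear g h w a b eg eh ew = trans (sum-+ (λ i → a * g i + b * h i) w)
  (cong₂ _+_ (trans (sum-+ (λ i → a * g i) (λ i → b * h i))
    (cong₂ _+_ (*-sum-const g a _ eg) (*-sum-const h b _ eh))) ew)

-- With sets of sizes |X| = n + 2d, |Y| = n, |Z| = n + d the code consists of the boxes X × Y × Z and
-- X′ × Y′ × Z′ and of z-cylinders over a (k + d)-regular graph on X × Y′ and a k-regular one on X′ × Y.
interpolation : ∀ {q} n d k → q ≡ (n + d) + (n + d) → 0 < n → k + k ≤ n →
  CodeExists q 2 (n + (d + d) + (k + k))
interpolation {q} n d k e 0<n 2k≤n = lineEquation⇒codeExists C (fromℕ< 0<q)
  (≤-trans 0<n (≤-trans (m≤m+n n (d + d)) (m≤m+n _ (k + k))))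
  (≤-trans (*-monoʳ-≤ 2 γ≤q) (≤-reflexive (*-comm 2 q)))
  (lineEquation-cong disjoint eqn)
  where
  n⁺ : ℕ
  n⁺ = n + (d + d)
  q≡n⁺+n : q ≡ n⁺ + n
  q≡n⁺+n = trans e (regroup n d)
    where
    regroup : ∀ n d → (n + d) + (n + d) ≡ n + (d + d) + n
    regroup = solve-∀
  q≡n+n⁺ : q ≡ n + n⁺
  q≡n+n⁺ = trans q≡n⁺+n (+-comm n⁺ n)
  0<q : 0 < q
  0<q = ≤-trans 0<n (≤-trans (m≤n+m n n⁺) (≤-reflexive (sym q≡n⁺+n)))
  γ≤q : n⁺ + (k + k) ≤ q
  γ≤q = ≤-trans (+-monoʳ-≤ n⁺ 2k≤n) (≤-reflexive (sym q≡n⁺+n))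
  k≤n : k ≤ n
  k≤n = ≤-trans (m≤m+n k k) 2k≤n
  splitˣ = complementary n⁺ n q≡n⁺+n
  splitʸ = complementary n n⁺ q≡n+n⁺
  splitᶻ = complementary (n + d) (n + d) e
  X Y Z : Fin q → Bool
  X = proj₁ splitˣ
  Y = proj₁ splitʸ
  Z = proj₁ splitᶻ
  size′ : ∀ {m I} → (∃[ A ] mem {q} {m} A ≡ I) → sum (λ i → 𝟙 (I i)) ≡ m
  size′ (A , refl) = size A
  -- `X` and `Y′` have equal size, as do `X′` and `Y`, so equal degrees on both sides balance.
  module U = Biregular (biregular′ {d = k + d} {k + d} (proj₁ (proj₂ splitˣ)) (proj₂ (proj₂ splitʸ))
    (≤-trans 0<n (m≤m+n n (d + d))) (+-mono-≤ k≤n (m≤m+n d d)) refl)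
  module V = Biregular (biregular′ {d = k} {k} (proj₂ (proj₂ splitˣ)) (proj₁ (proj₂ splitʸ)) 0<n k≤n refl)
  x x′ y y′ z z′ : Fin q → ℕ
  x i  = 𝟙 (X i)
  x′ i = 𝟙 (not (X i))
  y i  = 𝟙 (Y i)
  y′ i = 𝟙 (not (Y i))
  z i  = 𝟙 (Z i)
  z′ i = 𝟙 (not (Z i))
  w : Fin q → Fin q → ℕ
  w i j = 𝟙 (U.edge i j) + 𝟙 (V.edge i j)
  f : Fin q → Fin q → Fin q → ℕ
  f i j l = x i * y j * z l + x′ i * y′ j * z′ l + w i j
  C : Code q
  C (i , j , l) = (X i ∧ (Y j ∧ Z l)) ∨ ((not (X i) ∧ (not (Y j) ∧ not (Z l))) ∨ (U.edge i j ∨ V.edge i j))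
  disjoint : ∀ i j l → f i j l ≡ indicator C i j l
  disjoint i j l = go (X i) (Y j) (Z l) (U.inner i j) (V.inner i j)
    where
    go : ∀ X Y Z u v →
      𝟙 X * 𝟙 Y * 𝟙 Z + 𝟙 (not X) * 𝟙 (not Y) * 𝟙 (not Z) + (𝟙 (X ∧ (not Y ∧ u)) + 𝟙 (not X ∧ (Y ∧ v)))
      ≡ 𝟙 ((X ∧ (Y ∧ Z)) ∨ ((not X ∧ (not Y ∧ not Z)) ∨ ((X ∧ (not Y ∧ u)) ∨ (not X ∧ (Y ∧ v)))))
    go true  true  true  u v = refl
    go true  true  false u v = refl
    go true  false Z true  v = refl
    go true  false Z false v = refl
    go false true  Z u true  = refl
    go false true  Z u false = refl
    go false false true  u v = refl
    go false false false u v = refl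
  w-row : ∀ i → sum (λ j → w i j) ≡ (k + d) * x i + k * x′ i
  w-row i = trans (sum-+ _ _) (cong₂ _+_ (U.row i) (V.row i))
  w-column : ∀ j → sum (λ i → w i j) ≡ (k + d) * y′ j + k * y j
  w-column j = trans (sum-+ _ _) (cong₂ _+_ (U.column j) (V.column j))
  sizeˣ = size′ (proj₁ (proj₂ splitˣ))
  sizeˣ′ = size′ (proj₂ (proj₂ splitˣ))
  sizeʸ = size′ (proj₁ (proj₂ splitʸ))
  sizeʸ′ = size′ (proj₂ (proj₂ splitʸ))
  sizeᶻ = size′ (proj₁ (proj₂ splitᶻ))
  sizeᶻ′ = size′ (proj₂ (proj₂ splitᶻ))
  f-∣z : ∀ i j → ∣z f i j ≡ x i * y j * (n + d) + x′ i * y′ j * (n + d) + ((n + d) + (n + d)) * w i j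
  f-∣z i j = sum-linear z z′ (λ _ → w i j) (x i * y j) (x′ i * y′ j) sizeᶻ sizeᶻ′
    (trans (sum-const q (w i j)) (cong (_* w i j) e))
  f-∣y : ∀ i l → ∣y f i l ≡ x i * z l * n + x′ i * z′ l * n⁺ + ((k + d) * x i + k * x′ i)
  f-∣y i l = trans (sum-cong λ j → cong (_+ w i j) (cong₂ _+_ (swap (x i) (y j) (z l)) (swap (x′ i) (y′ j) (z′ l))))
    (sum-linear y y′ (w i) (x i * z l) (x′ i * z′ l) sizeʸ sizeʸ′ (w-row i))
    where
    swap : ∀ a b c → a * b * c ≡ a * c * b
    swap = solve-∀
  f-∣x : ∀ j l → ∣x f j l ≡ y j * z l * n⁺ + y′ j * z′ l * n + ((k + d) * y′ j + k * y j)
  f-∣x j l = trans (sum-cong λ i → cong (_+ w i j) (cong₂ _+_ (rotate (x i) (y j) (z l)) (rotate (x′ i) (y′ j) (z′ l))))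
    (sum-linear x x′ (λ i → w i j) (y j * z l) (y′ j * z′ l) sizeˣ sizeˣ′ (w-column j))
    where
    rotate : ∀ a b c → a * b * c ≡ b * c * a
    rotate = solve-∀
  eqn : LineEquation f 2 (n⁺ + (k + k))
  eqn i j l = begin
    lines f i j l + q * 2 * F
      ≡⟨ cong (_+ q * 2 * F) (cong₂ _+_ (cong₂ _+_ (f-∣z i j) (f-∣y i l)) (f-∣x j l)) ⟩
    _ ≡⟨ cong (_+ q * 2 * F) (interpolation-identity (X i) (Y j) (Z l) (U.inner i j) (V.inner i j) n d k) ⟩
    n⁺ + (k + k) + ((n + d) + (n + d)) * F + q * 2 * F
      ≡⟨ cong (λ t → n⁺ + (k + k) + t * F + q * 2 * F) e ⟨
    n⁺ + (k + k) + q * F + q * 2 * F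
      ≡⟨ regroup (n⁺ + (k + k)) q F ⟩
    n⁺ + (k + k) + 3 * q * F ∎
    where
    open ≡-Reasoning
    F : ℕ
    F = f i j l
    regroup : ∀ g q F → g + q * F + q * 2 * F ≡ g + 3 * q * F
    regroup = solve-∀

parity : ∀ n → ∃[ k ] (n ≡ k + k ⊎ n ≡ suc (k + k))
parity zero = 0 , inj₁ refl
parity (suc n) with parity n
... | k , inj₁ refl = k , inj₂ refl
... | k , inj₂ refl = suc k , inj₁ (cong suc (sym (+-suc k k)))

evenParameter : ∀ {q γ} → 0 < q → 2 ∣ γ → 0 < γ → γ ≤ q → CodeExists q 2 γ
evenParameter 0<q (divides k refl) = square-cylinder {k = k} 0<q

-- With `n + d = m` the parameter in `interpolation` is `m + d + 2k`, so `d` is taken to be the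
-- parity of `j`.
upperHalf : ∀ {m j} → 0 < m → j ≤ m → CodeExists (m + m) 2 (m + j)
upperHalf {m} {j} 0<m j≤m with parity j
... | k , inj₁ refl = subst (λ t → CodeExists (m + m) 2 (t + (k + k))) (+-identityʳ m)
  (interpolation m 0 k (cong₂ _+_ (sym (+-identityʳ m)) (sym (+-identityʳ m))) 0<m j≤m)
-- Here `d = 1` would leave `n = 0`, but the parameter is 2 and the even construction applies.
upperHalf {suc zero}    0<m (s≤s z≤n) | zero , inj₂ refl = evenParameter (s≤s z≤n) (divides 1 refl) (s≤s z≤n) ≤-refl
upperHalf {suc (suc n)} 0<m (s≤s 2k≤m) | k , inj₂ refl =
  subst (CodeExists (suc (suc n) + suc (suc n)) 2) (regroup n k)
    (interpolation (suc n) 1 k (cong₂ _+_ (+-comm 1 (suc n)) (+-comm 1 (suc n))) (s≤s z≤n) 2k≤m)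
  where
  regroup : ∀ n k → 1 + n + 2 + (k + k) ≡ suc (suc (n + suc (k + k)))
  regroup = solve-∀

sufficiency₂ : ∀ {q γ} → 2 ≤ q → Cond-λ2 q γ → CodeExists q 2 γ
sufficiency₂ 2≤q (even-γ 2∣γ 2≤γ γ≤q) = evenParameter (≤-trans (s≤s z≤n) 2≤q) 2∣γ (≤-trans (s≤s z≤n) 2≤γ) γ≤q
sufficiency₂ {q} {γ} 2≤q (even-q (divides m refl) q≤2γ γ≤q) =
  subst₂ (λ q γ → CodeExists q 2 γ) m+m≡m*2 (m+[n∸m]≡n m≤γ)
    (upperHalf (*-cancelʳ-< 2 0 m (≤-trans (s≤s z≤n) 2≤q))
      (+-cancelˡ-≤ m _ _ (≤-trans (≤-reflexive (m+[n∸m]≡n m≤γ)) (≤-trans γ≤q (≤-reflexive (sym m+m≡m*2))))))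
  where
  m+m≡m*2 : m + m ≡ m * 2
  m+m≡m*2 = trans (cong (m +_) (sym (+-identityʳ m))) (*-comm 2 m)
  m≤γ : m ≤ γ
  m≤γ = *-cancelˡ-≤ 2 (≤-trans (≤-reflexive (*-comm 2 m)) q≤2γ)
sufficiency₂ 2≤q (odd-γ 2∣q 2∤γ 2γ<q cond) = condition1⇒codeExists 2γ<q cond

-- Averages over lines and planes

module Averages {q} (f : Fin q → Fin q → Fin q → ℕ) where
  N : ℕ
  N = sum³ f

  planeˣ planeʸ : Fin q → ℕ
  planeˣ x = sum λ y → sum λ z → f x y z
  planeʸ y = sum λ x → sum λ z → f x y z

  N-y : sum planeʸ ≡ N
  N-y = sym (sum-comm _)

  -- The line itself is counted once from each of its `q` vertices, while the crossing lines sweep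
  -- out the two planes through it.
  sum-lines-z : ∀ x y → sum (lines f x y) ≡ q * ∣z f x y + planeˣ x + planeʸ y
  sum-lines-z x y = begin
    sum (λ z → ∣z f x y + ∣y f x z + ∣x f y z)
      ≡⟨ sum-+ (λ z → ∣z f x y + ∣y f x z) (∣x f y) ⟩
    sum (λ z → ∣z f x y + ∣y f x z) + sum (∣x f y)
      ≡⟨ cong (_+ sum (∣x f y)) (sum-+ (λ _ → ∣z f x y) (∣y f x)) ⟩
    sum {q} (λ _ → ∣z f x y) + sum (∣y f x) + sum (∣x f y)
      ≡⟨ cong₂ _+_ (cong₂ _+_ (sum-const q (∣z f x y)) (sym (sum-comm (f x)))) (sym (sum-comm λ x z → f x y z)) ⟩
    q * ∣z f x y + planeˣ x + planeʸ y ∎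
    where open ≡-Reasoning

  -- Each of the two directions inside the plane counts it `q` times, and the lines crossing it
  -- sweep out the whole cube.
  sum-lines-yz : ∀ x → sum (λ y → sum (lines f x y)) ≡ 2 * (q * planeˣ x) + N
  sum-lines-yz x = begin
    sum (λ y → sum (lines f x y))
      ≡⟨ sum-cong (sum-lines-z x) ⟩
    sum (λ y → q * ∣z f x y + planeˣ x + planeʸ y)
      ≡⟨ trans (sum-+ (λ y → q * ∣z f x y + planeˣ x) planeʸ) (cong (_+ sum planeʸ) (sum-+ (λ y → q * ∣z f x y) (λ _ → planeˣ x))) ⟩
    sum (λ y → q * ∣z f x y) + sum {q} (λ _ → planeˣ x) + sum planeʸ
      ≡⟨ cong₂ _+_ (cong₂ _+_ (sym (*-sum q (∣z f x))) (sum-const q (planeˣ x))) N-y ⟩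
    q * planeˣ x + q * planeˣ x + N
      ≡⟨ cong (λ t → q * planeˣ x + t + N) (+-identityʳ (q * planeˣ x)) ⟨
    2 * (q * planeˣ x) + N ∎
    where open ≡-Reasoning

  sum-lines : sum³ (lines f) ≡ 3 * (q * N)
  sum-lines = begin
    sum³ (lines f)                              ≡⟨ sum-cong sum-lines-yz ⟩
    sum (λ x → 2 * (q * planeˣ x) + N)          ≡⟨ sum-+ (λ x → 2 * (q * planeˣ x)) (λ _ → N) ⟩
    sum (λ x → 2 * (q * planeˣ x)) + sum {q} (λ _ → N)
      ≡⟨ cong₂ _+_ (trans (sym (*-sum 2 (λ x → q * planeˣ x))) (cong (2 *_) (sym (*-sum q planeˣ)))) (sum-const q N) ⟩
    2 * (q * N) + q * N                         ≡⟨ regroup (q * N) ⟩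
    3 * (q * N)                                 ∎
    where
    open ≡-Reasoning
    regroup : ∀ t → 2 * t + t ≡ 3 * t
    regroup = solve-∀

-- The constant `c` stands for `q (3 - i)`: it is `q` for the second eigenvalue and 0 for the third.
module AffineLines {q γ c} (f : Fin q → Fin q → Fin q → ℕ)
  (lines-affine : ∀ x y z → lines f x y z ≡ γ + c * f x y z) where
  open Averages f public

  sum-affine : ∀ {n} (g : Fin n → ℕ) a → sum (λ i → a + c * g i) ≡ n * a + c * sum g
  sum-affine {n} g a = trans (sum-+ (λ _ → a) (λ i → c * g i)) (cong₂ _+_ (sum-const n a) (sym (*-sum c g)))

  lineAverage : ∀ x y → q * ∣z f x y + planeˣ x + planeʸ y ≡ q * γ + c * ∣z f x y
  lineAverage x y = trans (sym (sum-lines-z x y)) (trans (sum-cong (lines-affine x y)) (sum-affine (f x y) γ))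

  planeAverage : ∀ x → 2 * (q * planeˣ x) + N ≡ q * (q * γ) + c * planeˣ x
  planeAverage x = trans (sym (sum-lines-yz x)) (trans
    (sum-cong λ y → trans (sum-cong (lines-affine x y)) (sum-affine (f x y) γ)) (sum-affine (∣z f x) (q * γ)))

  totalAverage : 3 * (q * N) ≡ q * (q * (q * γ)) + c * N
  totalAverage = trans (sym sum-lines) (trans
    (sum-cong λ x → trans (sum-cong λ y → trans (sum-cong (lines-affine x y)) (sum-affine (f x y) γ)) (sum-affine (∣z f x) (q * γ)))
    (sum-affine planeˣ (q * (q * γ))))

  -- Summing `lineAverage` over `x` gives the other plane direction without a second double sum of
  -- `lines`.
  planeAverage′ : ∀ y → 2 * (q * planeʸ y) + N ≡ q * (q * γ) + c * planeʸ y
  planeAverage′ y = begin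
    2 * (q * planeʸ y) + N
      ≡⟨ regroup (q * planeʸ y) N ⟩
    q * planeʸ y + N + q * planeʸ y
      ≡⟨ cong₂ _+_ (cong (_+ N) (*-sum q (λ x → ∣z f x y))) (sym (sum-const q (planeʸ y))) ⟩
    sum (λ x → q * ∣z f x y) + N + sum {q} (λ _ → planeʸ y)
      ≡⟨ trans (sum-+ (λ x → q * ∣z f x y + planeˣ x) (λ _ → planeʸ y))
               (cong (_+ sum {q} (λ _ → planeʸ y)) (sum-+ (λ x → q * ∣z f x y) planeˣ)) ⟨
    sum (λ x → q * ∣z f x y + planeˣ x + planeʸ y)
      ≡⟨ trans (sum-cong λ x → lineAverage x y) (sum-affine (λ x → ∣z f x y) (q * γ)) ⟩
    q * (q * γ) + c * planeʸ y ∎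
    where
    open ≡-Reasoning
    regroup : ∀ a n → 2 * a + n ≡ a + n + a
    regroup = solve-∀

-- Necessity for the first and third eigenvalues, parity for the second

necessity₁ : ∀ {q γ} → CodeExists q 1 γ → Cond-λ1 q γ
necessity₁ {q} {γ} (C , β , (_ , _ , 0<γ , _) , γ≤β , β+γ) =
  0<γ , ≤-trans (+-mono-≤ γ≤β (≤-reflexive (+-identityʳ γ))) (≤-reflexive (trans β+γ (*-identityʳ q)))

lineEquation₂ : ∀ {q γ} {f : Fin q → Fin q → Fin q → ℕ} → LineEquation f 2 γ →
  ∀ x y z → lines f x y z ≡ γ + q * f x y z
lineEquation₂ {q} {γ} {f} eqn x y z = +-cancelʳ-≡ (q * 2 * f x y z) _ _
  (trans (eqn x y z) (regroup q γ (f x y z)))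
  where
  regroup : ∀ q γ F → γ + 3 * q * F ≡ γ + q * F + q * 2 * F
  regroup = solve-∀

lineEquation₃ : ∀ {q γ} {f : Fin q → Fin q → Fin q → ℕ} → LineEquation f 3 γ →
  ∀ x y z → lines f x y z ≡ γ + 0 * f x y z
lineEquation₃ {q} {γ} {f} eqn x y z = +-cancelʳ-≡ (q * 3 * f x y z) _ _
  (trans (eqn x y z) (regroup q γ (f x y z)))
  where
  regroup : ∀ q γ F → γ + 3 * q * F ≡ γ + 0 * F + q * 3 * F
  regroup = solve-∀

-- A common line sum P, plane sum K and total N satisfy 3N = q²γ, hence 3K = qγ and 3P = γ.
necessity₃ : ∀ {q γ} → CodeExists q 3 γ → Cond-λ3 q γ
necessity₃ {q} {γ} (C , β , crc@(((x , y , z) , _) , _ , 0<γ , _) , γ≤β , β+γ) =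
  0<γ , divides (∣z f x y) (sym 3P≡γ) ,
  ≤-trans (+-mono-≤ γ≤β (≤-reflexive (+-identityʳ γ))) (≤-reflexive (trans β+γ (*-comm q 3)))
  where
  open ≡-Reasoning
  f : Fin q → Fin q → Fin q → ℕ
  f = indicator C
  open AffineLines {q} {γ} {0} f (lineEquation₃ (crc⇒lineEquation {i = 3} crc β+γ))
  instance
    q≢0 : NonZero q
    q≢0 = nonZeroIndex x
  3N : 3 * N ≡ q * (q * γ)
  3N = *-cancelˡ-≡ _ _ q (trans (regroup q N) (trans totalAverage (+-identityʳ _)))
    where
    regroup : ∀ q N → q * (3 * N) ≡ 3 * (q * N)
    regroup = solve-∀
  -- A general `K` serves both planes through the line.
  3K : ∀ {K} → 2 * (q * K) + N ≡ q * (q * γ) + 0 * K → 3 * K ≡ q * γ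
  3K {K} average = *-cancelˡ-≡ _ _ (2 * q) (+-cancelʳ-≡ (3 * N) _ _ (begin
    2 * q * (3 * K) + 3 * N           ≡⟨ regroup q K N ⟩
    3 * (2 * (q * K) + N)             ≡⟨ cong (3 *_) (trans average (+-identityʳ _)) ⟩
    3 * (q * (q * γ))                 ≡⟨ regroup′ q γ ⟩
    2 * q * (q * γ) + q * (q * γ)     ≡⟨ cong (2 * q * (q * γ) +_) 3N ⟨
    2 * q * (q * γ) + 3 * N           ∎))
    where
    instance
      2q≢0 : NonZero (2 * q)
      2q≢0 = m*n≢0 2 q
    regroup : ∀ q K N → 2 * q * (3 * K) + 3 * N ≡ 3 * (2 * (q * K) + N)
    regroup = solve-∀
    regroup′ : ∀ q γ → 3 * (q * (q * γ)) ≡ 2 * q * (q * γ) + q * (q * γ)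
    regroup′ = solve-∀
  3P≡γ : ∣z f x y * 3 ≡ γ
  3P≡γ = *-cancelˡ-≡ _ _ q (+-cancelʳ-≡ (q * γ + q * γ) _ _ (begin
    q * (P * 3) + (q * γ + q * γ)
      ≡⟨ cong (q * (P * 3) +_) (cong₂ _+_ (3K (planeAverage x)) (3K (planeAverage′ y))) ⟨
    q * (P * 3) + (3 * planeˣ x + 3 * planeʸ y) ≡⟨ regroup q P (planeˣ x) (planeʸ y) ⟩
    3 * (q * P + planeˣ x + planeʸ y)           ≡⟨ cong (3 *_) (trans (lineAverage x y) (+-identityʳ _)) ⟩
    3 * (q * γ)                                 ≡⟨ cong (λ t → q * γ + (q * γ + t)) (+-identityʳ (q * γ)) ⟩
    q * γ + (q * γ + q * γ)                     ∎))
    where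
    P = ∣z f x y
    regroup : ∀ q P K L → q * (P * 3) + (3 * K + 3 * L) ≡ 3 * (q * P + K + L)
    regroup = solve-∀

-- A plane contains qγ/2 points.
2∣q*γ : ∀ {q γ} {f : Fin q → Fin q → Fin q → ℕ} → Fin q → LineEquation f 2 γ → 2 ∣ q * γ
2∣q*γ {q} {γ} {f} x eqn = divides (planeˣ x) (sym (*-cancelˡ-≡ _ _ q (+-cancelʳ-≡ (q * (q * γ)) _ _ (begin
    q * (K * 2) + q * (q * γ)        ≡⟨ cong (q * (K * 2) +_) 2N ⟨
    q * (K * 2) + 2 * N              ≡⟨ regroup q K N ⟩
    2 * (q * K + N)                  ≡⟨ cong (2 *_) qK+N ⟩
    2 * (q * (q * γ))                ≡⟨ cong (q * (q * γ) +_) (+-identityʳ _) ⟩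
    q * (q * γ) + q * (q * γ)        ∎))))
  where
  open ≡-Reasoning
  open AffineLines {q} {γ} {q} f (lineEquation₂ eqn)
  instance
    q≢0 : NonZero q
    q≢0 = nonZeroIndex x
  K = planeˣ x
  regroup : ∀ q K N → q * (K * 2) + 2 * N ≡ 2 * (q * K + N)
  regroup = solve-∀
  qK+N : q * K + N ≡ q * (q * γ)
  qK+N = +-cancelʳ-≡ (q * K) _ _ (trans (rotate (q * K) N) (planeAverage x))
    where
    rotate : ∀ a n → a + n + a ≡ 2 * a + n
    rotate = solve-∀
  2N : 2 * N ≡ q * (q * γ)
  2N = *-cancelˡ-≡ _ _ q (+-cancelʳ-≡ (q * N) _ _ (trans (triple q N) totalAverage))
    where
    triple : ∀ q N → q * (2 * N) + q * N ≡ 3 * (q * N)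
    triple = solve-∀

-- Codes with eigenvalue λ₂ and 2γ < q

sum-mono : ∀ {n} {g h : Fin n → ℕ} → (∀ i → g i ≤ h i) → sum g ≤ sum h
sum-mono {zero}  {g} {h} le = ≤-reflexive (trans (sum-zero g) (sym (sum-zero h)))
sum-mono {suc n} {g} {h} le = subst₂ _≤_ (sym (sum-suc g)) (sym (sum-suc h))
  (+-mono-≤ (le zero) (sum-mono (le ∘ suc)))

term≤sum : ∀ {n} (g : Fin n → ℕ) i → g i ≤ sum g
term≤sum g zero    = ≤-trans (m≤m+n (g zero) _) (≤-reflexive (sym (sum-suc g)))
term≤sum g (suc i) = ≤-trans (term≤sum (g ∘ suc) i)
  (≤-trans (m≤n+m _ (g zero)) (≤-reflexive (sym (sum-suc g))))

sum≢0⇒∃ : ∀ {n} (g : Fin n → ℕ) → sum g ≢ 0 → ∃[ i ] g i ≢ 0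
sum≢0⇒∃ {n} g ne = ¬∀⟶∃¬ n (λ i → g i ≡ 0) (λ i → g i ≟ 0)
  (λ all0 → ne (trans (sum-cong all0) (trans (sum-const n 0) (*-zeroʳ n))))

sum-𝟙≢n⇒∃ : ∀ {n} (b : Fin n → Bool) → sum (λ i → 𝟙 (b i)) ≢ n → ∃[ i ] b i ≡ false
sum-𝟙≢n⇒∃ {n} b ne with ¬∀⟶∃¬ n (λ i → b i ≡ true) (λ i → b i Bool.≟ true)
  (λ all1 → ne (trans (sum-cong λ i → cong 𝟙 (all1 i)) (trans (sum-const n 1) (*-identityʳ n))))
... | i , bi≢true = i , ¬-not bi≢true

-- α, β, κ are the edge numbers of the three base graphs; α = 0 would force b = a + c.
odd-triangle : ∀ {q} a b c {κ α β} .{{_ : NonZero q}} → ¬ (2 ∣ a + b + c) →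
  c * q ≡ κ + α → a * q ≡ α + β → b * q ≡ β + κ → α ≢ 0
odd-triangle {q} a b c {κ} {α} {β} odd eᶜ eᵃ eᵇ refl = odd (divides b (begin
  a + b + c   ≡⟨ regroup a b c ⟩
  b + (a + c) ≡⟨ cong (b +_) b≡a+c ⟨
  b + b       ≡⟨ double b ⟩
  b * 2       ∎))
  where
  open ≡-Reasoning
  regroup : ∀ a b c → a + b + c ≡ b + (a + c)
  regroup = solve-∀
  double : ∀ b → b + b ≡ b * 2
  double = solve-∀
  b≡a+c : b ≡ a + c
  b≡a+c = *-cancelʳ-≡ _ _ q (begin
    b * q          ≡⟨ eᵇ ⟩
    β + κ          ≡⟨ cong₂ _+_ eᵃ (trans eᶜ (+-identityʳ κ)) ⟨
    a * q + c * q  ≡⟨ *-distribʳ-+ q a c ⟨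
    (a + c) * q    ∎)

m*n≢0⇒0<m : ∀ m {n} → m * n ≢ 0 → 0 < m
m*n≢0⇒0<m zero    ne = contradiction refl ne
m*n≢0⇒0<m (suc m) ne = s≤s z≤n

m*n≢0⇒0<n : ∀ m {n} → m * n ≢ 0 → 0 < n
m*n≢0⇒0<n m {n} ne = m*n≢0⇒0<m n (ne ∘ trans (*-comm m n))

-- Both sides count the edges of `g`.
double-count : ∀ {n} (g : Fin n → Fin n → ℕ) (I J : Fin n → Bool) d d′ →
  (∀ x → sum (g x) ≡ d * 𝟙 (I x)) → (∀ y → sum (λ x → g x y) ≡ d′ * 𝟙 (J y)) →
  d * sum (λ x → 𝟙 (I x)) ≡ d′ * sum (λ y → 𝟙 (J y))
double-count g I J d d′ row column = begin
  d * sum (λ x → 𝟙 (I x))    ≡⟨ *-sum d _ ⟩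
  sum (λ x → d * 𝟙 (I x))    ≡⟨ sum-cong row ⟨
  sum (λ x → sum (g x))      ≡⟨ sum-comm g ⟩
  sum (λ y → sum λ x → g x y) ≡⟨ sum-cong column ⟩
  sum (λ y → d′ * 𝟙 (J y))   ≡⟨ *-sum d′ _ ⟨
  d′ * sum (λ y → 𝟙 (J y))   ∎
  where open ≡-Reasoning

-- Some vertex of `I` exists, and its `d` neighbours all lie in `J`.
degree≤ : ∀ {n} (g : Fin n → Fin n → ℕ) (I J : Fin n → Bool) d →
  (∀ x → sum (g x) ≡ d * 𝟙 (I x)) → (∀ x y → g x y ≤ 𝟙 (J y)) →
  0 < sum (λ x → 𝟙 (I x)) → d ≤ sum (λ y → 𝟙 (J y))
degree≤ g I J d row support 0<I with sum≢0⇒∃ _ (>⇒≢ 0<I)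
... | x , Ix≢0 with I x | row x
...   | false | _ = contradiction refl Ix≢0
...   | true  | e = ≤-trans (≤-reflexive (trans (sym (*-identityʳ d)) (sym e))) (sum-mono (support x))

-- At most one of two competing degrees is nonzero, so it carries all of `c`; testing `u` tells
-- which.
exclusive : ∀ {u v c} → u + v ≡ c → (u ≢ 0 → v ≡ 0) →
  u ≡ c * 𝟙 (not (does (u ≟ 0))) × v ≡ c * 𝟙 (does (u ≟ 0))
exclusive {zero}  {v} {c} e excl = sym (*-zeroʳ c) , trans e (sym (*-identityʳ c))
exclusive {suc u} {v} {c} e excl =
  trans (sym (+-identityʳ (suc u))) (trans (trans (cong (suc u +_) (sym v≡0)) e) (sym (*-identityʳ c))) ,
  trans v≡0 (sym (*-zeroʳ c))
  where v≡0 = excl λ ()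

module LowDensity {q γ} (C : Code q) (o : Fin q) (γ-odd : ¬ (2 ∣ γ)) (2γ<q : 2 * γ < q)
  (lines-affine : ∀ x y z → lines (indicator C) x y z ≡ γ + q * indicator C x y z) where

  instance
    q≢0 : NonZero q
    q≢0 = nonZeroIndex o

  f : Fin q → Fin q → Fin q → ℕ
  f = indicator C

  γ<q : γ < q
  γ<q = ≤-<-trans (m≤m+n γ (γ + 0)) 2γ<q

  isFull : ℕ → ℕ
  isFull t = 𝟙 (does (t ≟ q))

  isFull-yes : ∀ {t} → t ≡ q → isFull t ≡ 1
  isFull-yes {t} e = cong 𝟙 (dec-true (t ≟ q) e)

  isFull-no : ∀ {t} → t ≢ q → isFull t ≡ 0
  isFull-no {t} ne = cong 𝟙 (dec-false (t ≟ q) ne)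

  isFull-inv : ∀ t → isFull t ≢ 0 → t ≡ q
  isFull-inv t ne with t ≟ q
  ... | yes e  = e
  ... | no ne′ = contradiction (isFull-no ne′) ne

  -- These are the base graphs of the future cylinders: an edge is the base point of a full line.
  p r s : Fin q → Fin q → ℕ
  p x y = isFull (∣z f x y)
  r x z = isFull (∣y f x z)
  s y z = isFull (∣x f y z)

  lines-outside : ∀ {x y z} → C (x , y , z) ≡ false → lines f x y z ≡ γ
  lines-outside {x} {y} {z} e = trans (lines-affine x y z)
    (trans (cong (λ b → γ + q * 𝟙 b) e) (trans (cong (γ +_) (*-zeroʳ q)) (+-identityʳ γ)))

  outside-z : ∀ {x y z} → C (x , y , z) ≡ false → ∣z f x y ≤ γ
  outside-z e = ≤-trans (≤-trans (m≤m+n _ _) (m≤m+n _ _)) (≤-reflexive (lines-outside e))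

  outside-y : ∀ {x y z} → C (x , y , z) ≡ false → ∣y f x z ≤ γ
  outside-y {x} {y} e = ≤-trans (≤-trans (m≤n+m _ (∣z f x y)) (m≤m+n _ _)) (≤-reflexive (lines-outside e))

  outside-x : ∀ {x y z} → C (x , y , z) ≡ false → ∣x f y z ≤ γ
  outside-x {x} {y} {z} e = ≤-trans (m≤n+m _ (∣z f x y + ∣y f x z)) (≤-reflexive (lines-outside e))

  small : ∀ {t} → t ≤ γ → isFull t ≡ 0
  small t≤γ = isFull-no (<⇒≢ (≤-<-trans t≤γ γ<q))

  data Fullness (t : ℕ) : Set where
    isfull  : t ≡ q → isFull t ≡ 1 → Fullness t
    notfull : t ≤ γ → isFull t ≡ 0 → Fullness t

  fullness : ∀ {t} → (t ≢ q → t ≤ γ) → Fullness t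
  fullness {t} le with t ≟ q
  ... | yes e = isfull e (isFull-yes e)
  ... | no ne = notfull (le ne) (isFull-no ne)

  fullness-z : ∀ x y → Fullness (∣z f x y)
  fullness-z x y = fullness λ ne → outside-z (proj₂ (sum-𝟙≢n⇒∃ _ ne))

  fullness-y : ∀ x z → Fullness (∣y f x z)
  fullness-y x z = fullness λ ne → outside-y (proj₂ (sum-𝟙≢n⇒∃ _ ne))

  fullness-x : ∀ y z → Fullness (∣x f y z)
  fullness-x y z = fullness λ ne → outside-x (proj₂ (sum-𝟙≢n⇒∃ _ ne))

  -- Two full lines would give `2q ≤ γ + q`, against `γ < q`; no full line would give `γ + q ≤ 3γ`,
  -- against `2γ < q`.
  oneFull : ∀ {t u v} → Fullness t → Fullness u → Fullness v → t + u + v ≡ γ + q →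
    isFull t + isFull u + isFull v ≡ 1
  oneFull {t} {u} {v} (isfull tq _) (isfull uq _) _ e = contradiction
    (+-cancelʳ-≤ q q γ (≤-trans (≤-reflexive (sym (cong₂ _+_ tq uq))) (≤-trans (m≤m+n _ v) (≤-reflexive e))))
    (<⇒≱ γ<q)
  oneFull {t} {u} {v} (isfull tq _) _ (isfull vq _) e = contradiction
    (+-cancelʳ-≤ q q γ (≤-trans (≤-reflexive (sym (cong₂ _+_ tq vq))) (≤-trans (+-monoˡ-≤ v (m≤m+n t u)) (≤-reflexive e))))
    (<⇒≱ γ<q)
  oneFull {t} {u} {v} _ (isfull uq _) (isfull vq _) e = contradiction
    (+-cancelʳ-≤ q q γ (≤-trans (≤-reflexive (sym (cong₂ _+_ uq vq))) (≤-trans (+-monoˡ-≤ v (m≤n+m u t)) (≤-reflexive e))))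
    (<⇒≱ γ<q)
  oneFull (notfull t≤ _) (notfull u≤ _) (notfull v≤ _) e = contradiction
    (+-cancelˡ-≤ γ q (2 * γ) (≤-trans (≤-reflexive (sym e)) (≤-trans (+-mono-≤ (+-mono-≤ t≤ u≤) v≤) (≤-reflexive (triple γ)))))
    (<⇒≱ 2γ<q)
    where
    triple : ∀ γ → γ + γ + γ ≡ γ + 2 * γ
    triple = solve-∀
  oneFull (isfull _ t1) (notfull _ u0) (notfull _ v0) e = cong₂ _+_ (cong₂ _+_ t1 u0) v0
  oneFull (notfull _ t0) (isfull _ u1) (notfull _ v0) e = cong₂ _+_ (cong₂ _+_ t0 u1) v0
  oneFull (notfull _ t0) (notfull _ u0) (isfull _ v1) e = cong₂ _+_ (cong₂ _+_ t0 u0) v1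

  open Cylinders p r s

  -- No full line passes through a vertex outside the code, and exactly one through a vertex of the
  -- code.
  f≡cylinders : ∀ x y z → f x y z ≡ cylinders x y z
  f≡cylinders x y z = go (C (x , y , z)) refl
    where
    go : ∀ b → C (x , y , z) ≡ b → 𝟙 (C (x , y , z)) ≡ cylinders x y z
    go false e = trans (cong 𝟙 e)
      (sym (cong₂ _+_ (cong₂ _+_ (small (outside-z e)) (small (outside-y e))) (small (outside-x e))))
    go true e = trans (cong 𝟙 e) (sym (oneFull (fullness-z x y) (fullness-y x z) (fullness-x y z)
      (trans (lines-affine x y z) (trans (cong (λ b → γ + q * 𝟙 b) e) (cong (γ +_) (*-identityʳ q))))))

  -- Both `cylinders-lines` and `lines-affine` evaluate the line sums with the same term `q * f`;
  -- cancelling it leaves the degrees and `γ`.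
  degree-sum : ∀ x y z → degˣ x + degʸ y + degᶻ z ≡ γ
  degree-sum x y z = +-cancelˡ-≡ (q * f x y z) _ _ (begin
    q * f x y z + (degˣ x + degʸ y + degᶻ z)          ≡⟨ cong (λ t → q * t + (degˣ x + degʸ y + degᶻ z)) (f≡cylinders x y z) ⟩
    q * cylinders x y z + (degˣ x + degʸ y + degᶻ z)  ≡⟨ cylinders-lines x y z ⟨
    lines cylinders x y z                             ≡⟨ lines-cong f≡cylinders x y z ⟨
    lines f x y z                                     ≡⟨ lines-affine x y z ⟩
    γ + q * f x y z                                   ≡⟨ +-comm γ _ ⟩
    q * f x y z + γ                                   ∎)
    where open ≡-Reasoning

  a b c : ℕ
  c = degˣ o
  b = degʸ o
  a = degᶻ o

  -- In `degree-sum` one coordinate can vary while the other two degrees stay fixed.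
  degˣ-const : ∀ x → degˣ x ≡ c
  degˣ-const x = +-cancelʳ-≡ _ _ _ (+-cancelʳ-≡ a _ _ (trans (degree-sum x o o) (sym (degree-sum o o o))))

  degʸ-const : ∀ y → degʸ y ≡ b
  degʸ-const y = +-cancelˡ-≡ c _ _ (+-cancelʳ-≡ a _ _ (trans (degree-sum o y o) (sym (degree-sum o o o))))

  degᶻ-const : ∀ z → degᶻ z ≡ a
  degᶻ-const z = +-cancelˡ-≡ (c + b) _ _ (trans (degree-sum o o z) (sym (degree-sum o o o)))

  -- A full line has `q` points, all supplied by its own cylinder, so no other cylinder meets it.
  saturated : ∀ t {u v} → isFull t ≢ 0 → t ≡ q * isFull t + u + v → u ≡ 0 × v ≡ 0
  saturated t {u} {v} full e = m+n≡0⇒m≡0 u u+v≡0 , m+n≡0⇒n≡0 u u+v≡0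
    where
    open ≡-Reasoning
    u+v≡0 : u + v ≡ 0
    u+v≡0 = +-cancelˡ-≡ q _ _ (begin
      q + (u + v)             ≡⟨ +-assoc q u v ⟨
      q + u + v               ≡⟨ cong (λ k → k + u + v) (*-identityʳ q) ⟨
      q * 1 + u + v           ≡⟨ cong (λ k → q * k + u + v) (isFull-yes (isFull-inv t full)) ⟨
      q * isFull t + u + v    ≡⟨ e ⟨
      t                       ≡⟨ isFull-inv t full ⟩
      q                       ≡⟨ +-identityʳ q ⟨
      q + 0                   ∎)

  p-excl : ∀ {x y} → p x y ≢ 0 → sum (λ z → r x z) ≡ 0 × sum (λ z → s y z) ≡ 0
  p-excl {x} {y} full = saturated (∣z f x y) full
    (trans (sum-cong (f≡cylinders x y)) (cylinders-∣z x y))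

  r-excl : ∀ {x z} → r x z ≢ 0 → sum (λ y → p x y) ≡ 0 × sum (λ y → s y z) ≡ 0
  r-excl {x} {z} full = saturated (∣y f x z) full
    (trans (sum-cong (λ y → f≡cylinders x y z)) (cylinders-∣y x z))

  s-excl : ∀ {y z} → s y z ≢ 0 → sum (λ x → p x y) ≡ 0 × sum (λ x → r x z) ≡ 0
  s-excl {y} {z} full = saturated (∣x f y z) full
    (trans (sum-cong (λ x → f≡cylinders x y z)) (cylinders-∣x y z))

  -- These sets recover the layout of `three-cylinders`: `p` lives on `R′ × S′`, `r` on `R × T′` and
  -- `s` on `S × T`.
  R S T : Fin q → Bool
  R x = does (sum (λ y → p x y) ≟ 0)
  S y = does (sum (λ x → p x y) ≟ 0)
  T z = does (sum (λ x → r x z) ≟ 0)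

  degreesˣ : ∀ x → sum (λ y → p x y) ≡ c * 𝟙 (not (R x)) × sum (λ z → r x z) ≡ c * 𝟙 (R x)
  degreesˣ x = exclusive (degˣ-const x) (λ ne → proj₁ (p-excl (proj₂ (sum≢0⇒∃ _ ne))))

  degreesʸ : ∀ y → sum (λ x → p x y) ≡ b * 𝟙 (not (S y)) × sum (λ z → s y z) ≡ b * 𝟙 (S y)
  degreesʸ y = exclusive (degʸ-const y) (λ ne → proj₂ (p-excl (proj₂ (sum≢0⇒∃ _ ne))))

  degreesᶻ : ∀ z → sum (λ x → r x z) ≡ a * 𝟙 (not (T z)) × sum (λ y → s y z) ≡ a * 𝟙 (T z)
  degreesᶻ z = exclusive (degᶻ-const z) (λ ne → proj₂ (r-excl (proj₂ (sum≢0⇒∃ _ ne))))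

  𝟙≤1 : ∀ b → 𝟙 b ≤ 1
  𝟙≤1 true  = ≤-refl
  𝟙≤1 false = z≤n

  -- Here `u` is a degree in a competing graph, which an edge forces to vanish.
  within : ∀ t {u} → (isFull t ≢ 0 → u ≡ 0) → isFull t ≤ 𝟙 (does (u ≟ 0))
  within t {u} zero-if-full with isFull t ≟ 0
  ... | yes e = ≤-trans (≤-reflexive e) z≤n
  ... | no ne = ≤-trans (𝟙≤1 (does (t ≟ q))) (≤-reflexive (sym (cong 𝟙 (dec-true (u ≟ 0) (zero-if-full ne)))))

  -- Here `u` is a degree in the same graph, to which the edge itself contributes.
  without : ∀ t {u} → isFull t ≤ u → isFull t ≤ 𝟙 (not (does (u ≟ 0)))
  without t {zero}  le = le
  without t {suc u} le = 𝟙≤1 (does (t ≟ q))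

  ∣R∣ ∣R′∣ ∣S∣ ∣S′∣ ∣T∣ ∣T′∣ : ℕ
  ∣R∣  = sum λ x → 𝟙 (R x)
  ∣R′∣ = sum λ x → 𝟙 (not (R x))
  ∣S∣  = sum λ x → 𝟙 (S x)
  ∣S′∣ = sum λ x → 𝟙 (not (S x))
  ∣T∣  = sum λ x → 𝟙 (T x)
  ∣T′∣ = sum λ x → 𝟙 (not (T x))

  sizes : ∀ (I : Fin q → Bool) → sum (λ x → 𝟙 (I x)) + sum (λ x → 𝟙 (not (I x))) ≡ q
  sizes I = sum-complement λ x → 𝟙-not (I x)

  count-p : c * ∣R′∣ ≡ b * ∣S′∣
  count-p = double-count p (not ∘ R) (not ∘ S) c b (proj₁ ∘ degreesˣ) (proj₁ ∘ degreesʸ)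

  count-r : c * ∣R∣ ≡ a * ∣T′∣
  count-r = double-count r R (not ∘ T) c a (proj₂ ∘ degreesˣ) (proj₁ ∘ degreesᶻ)

  count-s : b * ∣S∣ ≡ a * ∣T∣
  count-s = double-count s S T b a (proj₂ ∘ degreesʸ) (proj₂ ∘ degreesᶻ)

  total : ∀ d (I : Fin q → Bool) → d * q ≡ d * sum (λ x → 𝟙 (I x)) + d * sum (λ x → 𝟙 (not (I x)))
  total d I = trans (cong (d *_) (sym (sizes I))) (*-distribˡ-+ d _ _)

  -- The edge numbers of `p`, `r`, `s` are `c * ∣R′∣`, `c * ∣R∣`, `b * ∣S∣`. Each coordinate is an
  -- endpoint for two of the graphs, which gives the three equations fed to `odd-triangle`.
  c*q : c * q ≡ c * ∣R′∣ + c * ∣R∣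
  c*q = trans (total c R) (+-comm (c * ∣R∣) _)

  a*q : a * q ≡ c * ∣R∣ + b * ∣S∣
  a*q = trans (total a T) (trans (+-comm (a * ∣T∣) _) (cong₂ _+_ (sym count-r) (sym count-s)))

  b*q : b * q ≡ b * ∣S∣ + c * ∣R′∣
  b*q = trans (total b S) (cong (b * ∣S∣ +_) (sym count-p))

  degree-total : a + b + c ≡ γ
  degree-total = trans (regroup a b c) (degree-sum o o o)
    where
    regroup : ∀ a b c → a + b + c ≡ c + b + a
    regroup = solve-∀

  c∣R∣≢0 : c * ∣R∣ ≢ 0
  c∣R∣≢0 = odd-triangle a b c (γ-odd ∘ subst (2 ∣_) degree-total) c*q a*q b*q

  -- The hypotheses of `odd-triangle` are cyclically symmetric, so rotating the degrees reaches the
  -- other two edge numbers.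
  b∣S∣≢0 : b * ∣S∣ ≢ 0
  b∣S∣≢0 = odd-triangle b c a (γ-odd ∘ subst (2 ∣_) (trans (rotate a b c) degree-total)) a*q b*q c*q
    where
    rotate : ∀ a b c → b + c + a ≡ a + b + c
    rotate = solve-∀

  c∣R′∣≢0 : c * ∣R′∣ ≢ 0
  c∣R′∣≢0 = odd-triangle c a b (γ-odd ∘ subst (2 ∣_) (trans (rotate a b c) degree-total)) b*q c*q a*q
    where
    rotate : ∀ a b c → c + a + b ≡ a + b + c
    rotate = solve-∀

  -- The six upper bounds are `degree≤` at both ends of the three base graphs, the three equations
  -- are the double counts, and positivity comes from the nonzero edge numbers.
  condition1 : Condition1 q γ
  condition1 = ∣R∣ , ∣S∣ , ∣T∣ , a , b , c ,
    0<R , <q R 0<R′ , 0<S , <q S 0<S′ , 0<T , <q T 0<T′ ,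
    m*n≢0⇒0<m c c∣R∣≢0 ,
    subst (c ≤_) (rest S) (degree≤ p (not ∘ R) (not ∘ S) c (proj₁ ∘ degreesˣ) (λ x y → without (∣z f x y) (term≤sum (λ x → p x y) x)) 0<R′) ,
    subst (c ≤_) (rest T) (degree≤ r R (not ∘ T) c (proj₂ ∘ degreesˣ) (λ x z → without (∣y f x z) (term≤sum (λ x → r x z) x)) 0<R) ,
    m*n≢0⇒0<m b b∣S∣≢0 ,
    degree≤ s S T b (proj₂ ∘ degreesʸ) (λ y z → within (∣x f y z) (proj₂ ∘ s-excl {y} {z})) 0<S ,
    subst (b ≤_) (rest R) (degree≤ (λ y x → p x y) (not ∘ S) (not ∘ R) b (proj₁ ∘ degreesʸ) (λ y x → without (∣z f x y) (term≤sum (p x) y)) 0<S′) ,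
    m*n≢0⇒0<m a (c∣R∣≢0 ∘ trans count-r) ,
    degree≤ (λ z x → r x z) (not ∘ T) R a (proj₁ ∘ degreesᶻ) (λ z x → within (∣y f x z) (proj₁ ∘ r-excl {x} {z})) 0<T′ ,
    degree≤ (λ z y → s y z) T S a (proj₂ ∘ degreesᶻ) (λ z y → within (∣x f y z) (proj₁ ∘ s-excl {y} {z})) 0<T ,
    trans count-r (cong (a *_) (rest T)) ,
    trans (cong (b *_) (sym (rest S))) (trans (sym count-p) (cong (c *_) (rest R))) ,
    sym count-s ,
    sym degree-total
    where
    rest : ∀ I → sum (λ x → 𝟙 (not (I x))) ≡ q ∸ sum (λ x → 𝟙 (I x))
    rest I = trans (sym (m+n∸m≡n (sum λ x → 𝟙 (I x)) _)) (cong (_∸ sum (λ x → 𝟙 (I x))) (sizes I))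
    <q : ∀ I → 0 < sum (λ x → 𝟙 (not (I x))) → sum (λ x → 𝟙 (I x)) < q
    <q I pos = ≤-trans (m<m+n _ pos) (≤-reflexive (sizes I))
    0<R  = m*n≢0⇒0<n c c∣R∣≢0
    0<R′ = m*n≢0⇒0<n c c∣R′∣≢0
    0<S  = m*n≢0⇒0<n b b∣S∣≢0
    0<S′ = m*n≢0⇒0<n b (c∣R′∣≢0 ∘ trans count-p)
    0<T  = m*n≢0⇒0<n a (b∣S∣≢0 ∘ trans count-s)
    0<T′ = m*n≢0⇒0<n a (c∣R∣≢0 ∘ trans count-r)

-- Since `q * γ` is even, an odd `γ` forces `q` to be even; what remains is a split on `q ≤ 2 * γ`.
necessity₂ : ∀ {q γ} → CodeExists q 2 γ → Cond-λ2 q γ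
necessity₂ {q} {γ} (C , β , crc@(((x , _) , _) , _ , 0<γ , _) , γ≤β , β+γ) = cases (2 ∣? γ) (q ≤? 2 * γ)
  where
  eqn : LineEquation (indicator C) 2 γ
  eqn = crc⇒lineEquation {i = 2} crc β+γ
  γ≤q : γ ≤ q
  γ≤q = *-cancelˡ-≤ 2 (≤-trans (+-mono-≤ γ≤β (≤-reflexive (+-identityʳ γ)))
    (≤-reflexive (trans β+γ (*-comm q 2))))
  2≤γ : 2 ∣ γ → 2 ≤ γ
  2≤γ 2∣γ = ∣⇒≤ {{>-nonZero 0<γ}} 2∣γ
  2∣q : ¬ (2 ∣ γ) → 2 ∣ q
  2∣q 2∤γ = [ id , (λ 2∣γ → contradiction 2∣γ 2∤γ) ]′ (euclidsLemma q γ prime[2] (2∣q*γ x eqn))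
  cases : Dec (2 ∣ γ) → Dec (q ≤ 2 * γ) → Cond-λ2 q γ
  cases (yes 2∣γ) _          = even-γ 2∣γ (2≤γ 2∣γ) γ≤q
  cases (no 2∤γ) (yes q≤2γ)  = even-q (2∣q 2∤γ) q≤2γ γ≤q
  cases (no 2∤γ) (no q≰2γ)   = odd-γ (2∣q 2∤γ) 2∤γ (≰⇒> q≰2γ)
    (LowDensity.condition1 C x 2∤γ (≰⇒> q≰2γ) (lineEquation₂ eqn))

theorem7 : (q : ℕ) → 2 ≤ q → (γ : ℕ) →
    (CodeExists q 1 γ ⇔ Cond-λ1 q γ) ×
    (CodeExists q 2 γ ⇔ Cond-λ2 q γ) ×
    (CodeExists q 3 γ ⇔ Cond-λ3 q γ)
theorem7 q 2≤q γ =
  mk⇔ necessity₁ (sufficiency₁ 2≤q) ,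
  mk⇔ necessity₂ (sufficiency₂ 2≤q) ,
  mk⇔ necessity₃ (sufficiency₃ 2≤q)
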